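{- Let $\mathcal L$ be a finite language consisting of relation and/or constant symbols, and let $\mathcal H$ be a non-trivial basic hereditary $\mathcal L$-property. Then there are $k\in\mathbb N$ and polynomials $p_1,\dots,p_k$ with rational coefficients such that $|\mathcal H_n|=\sum_{i=1}^k p_i(n)i^n$ for all sufficiently large $n$.
   Context: A hereditary $\mathcal L$-property is a class $\mathcal H$ of $\mathcal L$-structures (finite or infinite) closed under isomorphism and under substructures (a substructure contains the interpretations of all constants). $\mathcal H_n$ is the set of members of $\mathcal H$ with underlying set $[n]$. $\mathcal H$ is trivial if $\mathcal H_n=\emptyset$ for all sufficiently large $n$. For an $\mathcal L$-structure $\mathcal M$ and $a,b\in M$, write $a\sim b$ iff the permutation of $M$ exchanging $a$ and $b$ and fixing all other elements is an automorphism of $\mathcal M$ (equivalently, $ab$ and $ba$ have the same quantifier-free type over $M\setminus\{a,b\}$); this is an equivalence relation. $\mathcal H$ is basic if there is $k\in\mathbb N$ such that every member of $\mathcal H$ has at most $k$ distinct $\sim$-classes. -}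

module Defs where

open import Data.Fin.Base using (Fin; toℕ)
open import Data.Integer.Base using (+_)
open import Data.Irrelevant using ([_])
open import Data.List.Base using (List; foldr)
open import Data.Nat.Base using (ℕ; suc; _≥_; _^_)
open import Data.Product.Base using (Σ; ∃; _×_; _,_; proj₁; proj₂)
open import Data.Rational.Base using (ℚ; 0ℚ; _/_; _+_; _*_)
open import Data.Rational.Properties using (+-0-commutativeMonoid)
open import Data.Refinement.Base using (Refinement; value)
open import Data.Vec.Base using (Vec; map)
open import Function.Base using (_on_)
open import Function.Bundles using (Bijection; Inverse; _↔_; _⇔_)
open import Function.Definitions using (Congruent; Injective)
open import Level using (Level; 0ℓ; _⊔_) renaming (suc to lsuc)
open import Relation.Binary.Bundles using (Setoid)
open import Relation.Binary.Construct.On using (isEquivalence)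
open import Relation.Binary.Core using (Rel)
open import Relation.Binary.PropositionalEquality using (_≡_; _≢_; refl; sym; trans; setoid)
open import Relation.Binary.Structures using (IsEquivalence)
open import Relation.Nullary.Negation.Core using (¬_)
open import Relation.Unary using (Pred; _≐_)
open import Relation.Unary.Properties using (≐-refl; ≐-sym; ≐-trans)
open import Algebra.Properties.CommutativeMonoid.Sum +-0-commutativeMonoid using (sum)

record Language : Set where
  field
    #relations : ℕ
    arity      : Fin #relations → ℕ
    #constants : ℕ

module _ (L : Language) where
  open Language L

  record Interpretation (A : Set) : Set₁ where
    field
      rel   : (R : Fin #relations) → Pred (Vec A (arity R)) 0ℓ
      const : Fin #constants → A

  record Structure : Set₁ where
    constructor structure
    field
      Carrier        : Set
      interpretation : Interpretation Carrier
    open Interpretation interpretation public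

module _ {L : Language} where
  open Language L
  open Structure
  private module I = Interpretation

  infix 4 _≅_ _≈_

  record _≅_ (M N : Structure L) : Set where
    field
      bijection : Carrier M ↔ Carrier N
    open Inverse bijection public using (to; from)
    field
      rel-⇔   : ∀ R xs → rel M R xs ⇔ rel N R (map to xs)
      const-≡ : ∀ c → to (const M c) ≡ const N c

  -- The subset P of M is represented by the type of elements of M equipped with
  -- an irrelevant proof of P, so that it has exactly one element for each x in P.
  substructure : (M : Structure L) (P : Pred (Carrier M) 0ℓ) →
                 (∀ c → P (const M c)) → Structure L
  substructure M P closed = structure (Refinement (Carrier M) P) record
    { rel   = λ R xs → rel M R (map value xs)
    ; const = λ c → record { value = const M c ; proof = [ closed c ] }
    }

  record Hereditary {ℓ : Level} (H : Pred (Structure L) ℓ) : Set (lsuc 0ℓ ⊔ ℓ) where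
    field
      ≅-closed            : ∀ {M N} → M ≅ N → H M → H N
      substructure-closed : ∀ M P closed → H M → H (substructure M P closed)

  -- Equality of structures on the same underlying set. Relations are compared
  -- extensionally, as subsets of a power of that set.
  _≈_ : {A : Set} → Rel (Interpretation L A) 0ℓ
  I ≈ J = (∀ R → I.rel I R ≐ I.rel J R) × (∀ c → I.const I c ≡ I.const J c)

  ≈-isEquivalence : {A : Set} → IsEquivalence (_≈_ {A})
  ≈-isEquivalence = record
    { refl  = (λ _ → ≐-refl) , (λ _ → refl)
    ; sym   = λ (p , q) → (λ R → ≐-sym (p R)) , (λ c → sym (q c))
    ; trans = λ (p , q) (p′ , q′) →
        (λ R → ≐-trans (p R) (p′ R)) , (λ c → trans (q c) (q′ c))
    }

  -- The members of H with underlying set [n], for which we take Fin n.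
  members : {ℓ : Level} → Pred (Structure L) ℓ → ℕ → Setoid (lsuc 0ℓ ⊔ ℓ) 0ℓ
  members H n = record
    { Carrier       = Σ (Interpretation L (Fin n)) λ I → H (structure (Fin n) I)
    ; _≈_           = _≈_ on proj₁
    ; isEquivalence = isEquivalence proj₁ ≈-isEquivalence
    }

  Trivial : {ℓ : Level} → Pred (Structure L) ℓ → Set (lsuc 0ℓ ⊔ ℓ)
  Trivial H = ∃ λ N → ∀ n → n ≥ N → ¬ Setoid.Carrier (members H n)

  -- Stated through "some automorphism acting as the transposition of a and b",
  -- because the transposition is only definable as a function when equality on
  -- the carrier is decidable.
  Interchangeable : (M : Structure L) → Rel (Carrier M) 0ℓ
  Interchangeable M a b = Σ (M ≅ M) λ σ →
    let open _≅_ σ in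
    to a ≡ b × to b ≡ a × (∀ c → c ≢ a → c ≢ b → to c ≡ c)

  -- The quotient of M by interchangeability embeds into Fin k.
  AtMostClasses : ℕ → Structure L → Set
  AtMostClasses k M = Σ (Carrier M → Fin k) λ f →
    Congruent (Interchangeable M) _≡_ f × Injective (Interchangeable M) _≡_ f

  Basic : {ℓ : Level} → Pred (Structure L) ℓ → Set (lsuc 0ℓ ⊔ ℓ)
  Basic H = ∃ λ k → ∀ M → H M → AtMostClasses k M

HasCardinality : {a ℓ : Level} → Setoid a ℓ → ℕ → Set (a ⊔ ℓ)
HasCardinality S m = Bijection (setoid (Fin m)) S

fromℕ : ℕ → ℚ
fromℕ n = + n / 1

-- Coefficient lists, constant term first; trailing zeros are harmless.
Polynomial : Set
Polynomial = List ℚ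

eval : Polynomial → ℚ → ℚ
eval p x = foldr (λ c acc → c + x * acc) 0ℚ p

-- p₁(n) 1ⁿ + ⋯ + pₖ(n) kⁿ, where pᵢ is stored at index i − 1 of Fin k.
polyExpSum : {k : ℕ} → (Fin k → Polynomial) → ℕ → ℚ
polyExpSum p n = sum λ i → eval (p i) (fromℕ n) * fromℕ (suc (toℕ i) ^ n)

{-# OPTIONS --safe #-}

-- Fix k bounding the number of ∼-classes. A member of H with underlying set [n] is
-- determined by a colouring w of [n] by its classes and by a template, which records the
-- truth values of the relations in terms of the colours and the equality type of a tuple;
-- there are finitely many templates. The colouring becomes unique when it is required to
-- be a restricted growth word. For a fixed template, whether a word gives a member of H
-- whose classes are exactly the colour classes is a conjunction of conditions each of
-- which persists, in one direction, under embeddings, and so by Dickson's lemma depends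
-- only on the colour counts truncated at some B. Counting such words by their first
-- letter, a colour already used B times changes nothing, so the numbers satisfy recurrences
-- a(n+1) = d a(n) + g(n) with d ≤ k and g known by induction on the distance to
-- saturation; such recurrences preserve exponential polynomials.

module Submission where

open import Defs
open import Axiom.ExcludedMiddle using (ExcludedMiddle)
open import Data.Bool.Base using (Bool; true; false; if_then_else_)
open import Data.Fin.Base as Fin using (Fin; zero; suc; toℕ; fromℕ<; punchIn)
open import Data.Fin.Permutation.Components using (transpose)
import Data.Fin.Properties as Finₚ
open import Data.Irrelevant using ([_])
open import Data.List.Base as List
  using (List; []; _∷_; _++_; allFin; length; filter; cartesianProductWith; cartesianProduct; concatMap; upTo)
import Data.List.Properties as Listₚ
open import Data.List.Membership.Propositional using (_∈_; lose)
import Data.List.Membership.Propositional.Properties as ∈ₚ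
open import Data.List.Relation.Unary.All as All using ([]; _∷_)
open import Data.List.Relation.Unary.Any using (here; there; index)
import Data.List.Relation.Unary.Any.Properties as Anyₚ
open import Data.List.Relation.Unary.Unique.Propositional using (Unique; []; _∷_)
import Data.List.Relation.Unary.Unique.Propositional.Properties as Uniqueₚ
open import Data.Nat.Base as ℕ using (ℕ; zero; suc; _≤_; _<_; _≥_; z≤n; s≤s)
open import Data.Nat.ListAction using () renaming (sum to listSum)
import Data.Nat.Properties as ℕₚ
open import Data.Product.Base using (Σ; ∃; _×_; _,_; proj₁; proj₂)
open import Data.Refinement.Base using (Refinement; _,_; value)
open import Data.Refinement.Properties using (value-injective)
open import Data.Sum.Base using (_⊎_; inj₁; inj₂; [_,_]′)
open import Data.Unit.Base using (⊤; tt)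
open import Data.Vec.Base as Vec using (Vec; []; _∷_; lookup; removeAt)
import Data.Vec.Functional as F
import Data.Vec.Properties as Vecₚ
open import Function.Base using (_∘_)
open import Function.Bundles using (_⇔_; mk⇔; Equivalence; mk↔ₛ′)
open import Function.Definitions using (Injective)
open import Level using (Level; 0ℓ) renaming (suc to lsuc; _⊔_ to _⊔ˡ_)
open import Relation.Binary.Bundles using (Setoid)
open import Relation.Binary.Definitions using (tri<; tri≈; tri>)
open import Relation.Binary.PropositionalEquality
  using (_≡_; _≢_; refl; sym; trans; cong; cong₂; subst; module ≡-Reasoning)
open import Relation.Binary.Structures using (IsEquivalence)
open import Relation.Nullary using (Dec; yes; no; does; contradiction; recompute)
open import Relation.Nullary.Decidable using (dec-true; dec-false; does-⇔; decidable-stable)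
open import Relation.Nullary.Negation.Core using (¬_)
open import Relation.Unary using (Pred)

-- Restricting along a colour-preserving embedding may lose information: if a colour disappears, a
-- constant can lose its element, and two classes told apart only by that colour can merge. The
-- order `⊑` therefore lets no letter appear or vanish. Along it, realizability passes from the
-- larger word to the smaller, while separation and fullness pass upwards. Each is one-directional,
-- but agreement of truncated counts is symmetric, so all three become invariants of the truncation.
-- Restricted growth depends on the order of the letters and not only on their counts, which is why
-- words are counted letter by letter, with the counts read so far as the state.

-- Exponential polynomials and first-order linear recurrences.

module ExponentialPolynomials where

  import Data.Integer.Base as ℤ
  import Data.Integer.Properties as ℤₚ
  open import Data.Nat.Base using (_^_)
  import Data.Nat.Coprimality as Coprimality
  open import Data.Rational.Base as ℚ using (ℚ; mkℚ; 0ℚ; 1ℚ; _+_; _*_; _-_; -_; 1/_)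
  import Data.Rational.Properties as ℚₚ
  open import Data.Rational.Solver using (module +-*-Solver)
  import Data.Rational.Unnormalised.Base as ℚᵘ
  import Data.Rational.Unnormalised.Properties as ℚᵘₚ
  open import Algebra.Bundles using (CommutativeRing)
  open import Algebra.Properties.CommutativeMonoid.Sum ℚₚ.+-0-commutativeMonoid
    using (sum; sum-cong-≗; ∑-distrib-+)
  open import Algebra.Properties.Semiring.Sum
    (CommutativeRing.semiring ℚₚ.+-*-commutativeRing) using (*-distribˡ-sum)

  -- `fromℕ n` goes through a gcd normalisation that does not reduce for a variable `n`. Here
  -- numerator and denominator are visible, so identities can be checked on unnormalised fractions.
  integral : ℕ → ℚ
  integral n = mkℚ (ℤ.+ n) 0 (Coprimality.sym (Coprimality.1-coprimeTo n))

  fromℕ-integral : ∀ n → fromℕ n ≡ integral n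
  fromℕ-integral n = ℚₚ.normalize-coprime (Coprimality.sym (Coprimality.1-coprimeTo n))

  fromℕ-+ : ∀ m n → fromℕ (m ℕ.+ n) ≡ fromℕ m + fromℕ n
  fromℕ-+ m n rewrite fromℕ-integral m | fromℕ-integral n | fromℕ-integral (m ℕ.+ n) =
    ℚₚ.toℚᵘ-injective (ℚᵘₚ.≃-trans
      (ℚᵘ.*≡* (cong (ℤ._* ℤ.+ 1) (trans (ℤₚ.pos-+ m n)
        (sym (cong₂ ℤ._+_ (ℤₚ.*-identityʳ (ℤ.+ m)) (ℤₚ.*-identityʳ (ℤ.+ n)))))))
      (ℚᵘₚ.≃-sym (ℚₚ.toℚᵘ-homo-+ (integral m) (integral n))))

  fromℕ-* : ∀ m n → fromℕ (m ℕ.* n) ≡ fromℕ m * fromℕ n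
  fromℕ-* m n rewrite fromℕ-integral m | fromℕ-integral n | fromℕ-integral (m ℕ.* n) =
    ℚₚ.toℚᵘ-injective (ℚᵘₚ.≃-trans
      (ℚᵘ.*≡* (cong (ℤ._* ℤ.+ 1) (ℤₚ.pos-* m n)))
      (ℚᵘₚ.≃-sym (ℚₚ.toℚᵘ-homo-* (integral m) (integral n))))

  fromℕ-suc : ∀ n → fromℕ (suc n) ≡ 1ℚ + fromℕ n
  fromℕ-suc = fromℕ-+ 1

  fromℕ-injective : ∀ {m n} → fromℕ m ≡ fromℕ n → m ≡ n
  fromℕ-injective {m} {n} eq = ℤₚ.+-injective (proj₁ (ℚₚ.mkℚ-injective
    {c₁ = Coprimality.sym (Coprimality.1-coprimeTo m)}
    {c₂ = Coprimality.sym (Coprimality.1-coprimeTo n)}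
    (trans (sym (fromℕ-integral m)) (trans eq (fromℕ-integral n)))))

  invertible : ∀ x → x ≢ 0ℚ → ∃ λ y → y * x ≡ 1ℚ
  invertible x x≢0 = 1/ x , ℚₚ.*-inverseˡ x
    where instance
      x-nonZero : ℚ.NonZero x
      x-nonZero = ℚ.≢-nonZero x≢0

  fromℕ-invertible : ∀ n → n ≢ 0 → ∃ λ y → y * fromℕ n ≡ 1ℚ
  fromℕ-invertible n n≢0 = invertible (fromℕ n) (n≢0 ∘ fromℕ-injective)

  x-y≡0⇒x≡y : ∀ {x y} → x - y ≡ 0ℚ → x ≡ y
  x-y≡0⇒x≡y {x} {y} eq = begin
    x            ≡⟨ solve 2 (λ x y → x := (x :- y) :+ y) refl x y ⟩
    (x - y) + y  ≡⟨ cong (_+ y) eq ⟩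
    0ℚ + y       ≡⟨ ℚₚ.+-identityˡ y ⟩
    y            ∎
    where
    open ≡-Reasoning
    open +-*-Solver

  -- The sequence with iterated differences at 0 given by the list, that is
  -- n ↦ c₀ C(n,0) + c₁ C(n,1) + ⋯.
  newton : List ℚ → ℕ → ℚ
  newton []       n       = 0ℚ
  newton (c ∷ cs) zero    = c
  newton (c ∷ cs) (suc n) = newton (c ∷ cs) n + newton cs n

  infixl 6 _⊞_

  _⊞_ : List ℚ → List ℚ → List ℚ
  []       ⊞ ds       = ds
  (c ∷ cs) ⊞ []       = c ∷ cs
  (c ∷ cs) ⊞ (d ∷ ds) = (c + d) ∷ (cs ⊞ ds)

  newton-⊞ : ∀ cs ds n → newton (cs ⊞ ds) n ≡ newton cs n + newton ds n
  newton-⊞ []       ds       n       = sym (ℚₚ.+-identityˡ _)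
  newton-⊞ (c ∷ cs) []       n       = sym (ℚₚ.+-identityʳ _)
  newton-⊞ (c ∷ cs) (d ∷ ds) zero    = refl
  newton-⊞ (c ∷ cs) (d ∷ ds) (suc n) =
    trans (cong₂ _+_ (newton-⊞ (c ∷ cs) (d ∷ ds) n) (newton-⊞ cs ds n))
          (solve 4 (λ x y z w → (x :+ y) :+ (z :+ w) := (x :+ z) :+ (y :+ w)) refl
             (newton (c ∷ cs) n) (newton (d ∷ ds) n) (newton cs n) (newton ds n))
    where
    open +-*-Solver

  newton-map-* : ∀ r cs n → newton (List.map (r *_) cs) n ≡ r * newton cs n
  newton-map-* r []       n       = sym (ℚₚ.*-zeroʳ r)
  newton-map-* r (c ∷ cs) zero    = refl
  newton-map-* r (c ∷ cs) (suc n) =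
    trans (cong₂ _+_ (newton-map-* r (c ∷ cs) n) (newton-map-* r cs n))
          (sym (ℚₚ.*-distribˡ-+ r _ _))

  -- If b ≠ d, the operator q ↦ b q(n+1) − d q(n) commutes with the difference operator
  -- and is invertible on constants; if b = d, it is b times the difference operator.
  newton-recurrence : ∀ b d → b ≢ 0 → (cs : List ℚ) → ∃ λ ds → ∀ n →
    fromℕ b * newton ds (suc n) ≡ fromℕ d * newton ds n + newton cs n
  newton-recurrence b d b≢0 cs with b ℕₚ.≟ d
  ... | yes refl = 0ℚ ∷ List.map (1/b *_) cs , λ n → begin
      B * (newton (0ℚ ∷ List.map (1/b *_) cs) n + newton (List.map (1/b *_) cs) n)
        ≡⟨ cong (λ z → B * (newton (0ℚ ∷ List.map (1/b *_) cs) n + z)) (newton-map-* 1/b cs n) ⟩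
      B * (newton (0ℚ ∷ List.map (1/b *_) cs) n + 1/b * newton cs n)
        ≡⟨ solve 4 (λ b x y z → b :* (x :+ y :* z) := b :* x :+ (y :* b) :* z) refl
             B (newton (0ℚ ∷ List.map (1/b *_) cs) n) 1/b (newton cs n) ⟩
      B * newton (0ℚ ∷ List.map (1/b *_) cs) n + (1/b * B) * newton cs n
        ≡⟨ cong (λ z → B * newton (0ℚ ∷ List.map (1/b *_) cs) n + z)
             (trans (cong (_* newton cs n) (proj₂ (fromℕ-invertible b b≢0))) (ℚₚ.*-identityˡ _)) ⟩
      B * newton (0ℚ ∷ List.map (1/b *_) cs) n + newton cs n ∎
    where
    open ≡-Reasoning
    open +-*-Solver
    B = fromℕ b
    1/b = proj₁ (fromℕ-invertible b b≢0)
  ... | no b≢d = solution cs , solves cs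
    where
    open ≡-Reasoning
    open +-*-Solver
    B = fromℕ b
    D = fromℕ d
    B-D-inverse = invertible (B - D) (λ eq → b≢d (fromℕ-injective (x-y≡0⇒x≡y eq)))
    1/[b-d] = proj₁ B-D-inverse

    solution : List ℚ → List ℚ
    solution []       = []
    solution (c ∷ cs) = (c - B * newton (solution cs) 0) * 1/[b-d] ∷ solution cs

    solves : ∀ cs n → B * newton (solution cs) (suc n) ≡ D * newton (solution cs) n + newton cs n
    solves []       n    = trans (ℚₚ.*-zeroʳ B) (sym (trans (ℚₚ.+-identityʳ _) (ℚₚ.*-zeroʳ D)))
    solves (c ∷ cs) zero = begin
      B * ((c - B * e) * 1/[b-d] + e)
        ≡⟨ solve 5 (λ b d c e r → b :* ((c :- b :* e) :* r :+ e) :=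
             d :* ((c :- b :* e) :* r) :+ (r :* (b :- d)) :* (c :- b :* e) :+ b :* e) refl B D c e 1/[b-d] ⟩
      D * ((c - B * e) * 1/[b-d]) + (1/[b-d] * (B - D)) * (c - B * e) + B * e
        ≡⟨ cong (λ z → D * ((c - B * e) * 1/[b-d]) + z * (c - B * e) + B * e) (proj₂ B-D-inverse) ⟩
      D * ((c - B * e) * 1/[b-d]) + 1ℚ * (c - B * e) + B * e
        ≡⟨ solve 4 (λ x c b e → x :+ con 1ℚ :* (c :- b :* e) :+ b :* e := x :+ c) refl
             (D * ((c - B * e) * 1/[b-d])) c B e ⟩
      D * ((c - B * e) * 1/[b-d]) + c ∎
      where e = newton (solution cs) 0
    solves (c ∷ cs) (suc n) = begin
      B * (newton s (suc n) + newton s′ (suc n))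
        ≡⟨ ℚₚ.*-distribˡ-+ B _ _ ⟩
      B * newton s (suc n) + B * newton s′ (suc n)
        ≡⟨ cong₂ _+_ (solves (c ∷ cs) n) (solves cs n) ⟩
      (D * newton s n + newton (c ∷ cs) n) + (D * newton s′ n + newton cs n)
        ≡⟨ solve 5 (λ d x y z w → (d :* x :+ y) :+ (d :* z :+ w) := d :* (x :+ z) :+ (y :+ w)) refl
             D (newton s n) (newton (c ∷ cs) n) (newton s′ n) (newton cs n) ⟩
      D * (newton s n + newton s′ n) + (newton (c ∷ cs) n + newton cs n) ∎
      where
      s  = solution (c ∷ cs)
      s′ = solution cs

  sum-zero : ∀ {K} (f : Fin K → ℚ) → (∀ i → f i ≡ 0ℚ) → sum f ≡ 0ℚ
  sum-zero {zero}  f f≡0 = refl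
  sum-zero {suc K} f f≡0 = cong₂ _+_ (f≡0 zero) (sum-zero (f ∘ suc) (f≡0 ∘ suc))

  sum-supported-at : ∀ {K} (i : Fin K) (f : Fin K → ℚ) → (∀ j → j ≢ i → f j ≡ 0ℚ) → sum f ≡ f i
  sum-supported-at zero    f f≡0 =
    trans (cong (f zero +_) (sum-zero _ λ j → f≡0 (suc j) λ ())) (ℚₚ.+-identityʳ _)
  sum-supported-at (suc i) f f≡0 =
    trans (cong₂ _+_ (f≡0 zero λ ())
            (sum-supported-at i (f ∘ suc) (λ j j≢i → f≡0 (suc j) (j≢i ∘ Finₚ.suc-injective))))
          (ℚₚ.+-identityˡ _)

  newtonExpSum : ∀ {K} → (Fin K → List ℚ) → ℕ → ℚ
  newtonExpSum p n = sum λ i → newton (p i) n * fromℕ (suc (toℕ i) ^ n)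

  -- Index `i` carries the base `i + 1`; base 0 would only affect finitely many values, which the
  -- threshold absorbs. Newton coefficients are kept until the end because the difference operator
  -- acts on them as a shift.
  record EventuallyExpPoly (K : ℕ) (a : ℕ → ℕ) : Set where
    constructor eventually
    field
      coefficients : Fin K → List ℚ
      threshold    : ℕ
      agrees       : ∀ n → n ≥ threshold → fromℕ (a n) ≡ newtonExpSum coefficients n

  module _ {K : ℕ} where

    newtonExpSum-⊞ : ∀ (p q : Fin K → List ℚ) n →
      newtonExpSum (λ i → p i ⊞ q i) n ≡ newtonExpSum p n + newtonExpSum q n
    newtonExpSum-⊞ p q n = trans
      (sum-cong-≗ λ i → trans (cong (_* fromℕ (suc (toℕ i) ^ n)) (newton-⊞ (p i) (q i) n))
                              (ℚₚ.*-distribʳ-+ (fromℕ (suc (toℕ i) ^ n)) (newton (p i) n) (newton (q i) n)))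
      (∑-distrib-+ (λ i → newton (p i) n * fromℕ (suc (toℕ i) ^ n)) _)

    expPoly-cong : ∀ {a b} → (∀ n → a n ≡ b n) → EventuallyExpPoly K a → EventuallyExpPoly K b
    expPoly-cong a≗b (eventually p N eq) = eventually p N λ n n≥N → trans (cong fromℕ (sym (a≗b n))) (eq n n≥N)

    expPoly-0 : EventuallyExpPoly K (λ _ → 0)
    expPoly-0 = eventually (λ _ → []) 0 λ n _ →
      sym (sum-zero {K} _ λ i → ℚₚ.*-zeroˡ (fromℕ (suc (toℕ i) ^ n)))

    expPoly-+ : ∀ {a b} → EventuallyExpPoly K a → EventuallyExpPoly K b →
                EventuallyExpPoly K (λ n → a n ℕ.+ b n)
    expPoly-+ {a} {b} (eventually p M a-eq) (eventually q N b-eq) = eventually (λ i → p i ⊞ q i) (M ℕ.⊔ N) λ n n≥ → begin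
      fromℕ (a n ℕ.+ b n)
        ≡⟨ fromℕ-+ (a n) (b n) ⟩
      fromℕ (a n) + fromℕ (b n)
        ≡⟨ cong₂ _+_ (a-eq n (ℕₚ.≤-trans (ℕₚ.m≤m⊔n M N) n≥)) (b-eq n (ℕₚ.≤-trans (ℕₚ.m≤n⊔m M N) n≥)) ⟩
      newtonExpSum p n + newtonExpSum q n
        ≡⟨ newtonExpSum-⊞ p q n ⟨
      newtonExpSum (λ i → p i ⊞ q i) n ∎
      where
      open ≡-Reasoning

    single : Fin K → ℚ → Fin K → List ℚ
    single i c j = if does (j Finₚ.≟ i) then c ∷ [] else []

    newtonExpSum-single : ∀ i c n → newtonExpSum (single i c) n ≡ c * fromℕ (suc (toℕ i) ^ n)
    newtonExpSum-single i c n = trans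
      (sum-supported-at i _ λ j j≢i →
        trans (cong (λ b → newton (if b then c ∷ [] else []) n * fromℕ (suc (toℕ j) ^ n))
                    (dec-false (j Finₚ.≟ i) j≢i))
              (ℚₚ.*-zeroˡ (fromℕ (suc (toℕ j) ^ n))))
      (trans (cong (λ b → newton (if b then c ∷ [] else []) n * fromℕ (suc (toℕ i) ^ n))
                   (dec-true (i Finₚ.≟ i) refl))
             (cong (_* fromℕ (suc (toℕ i) ^ n)) (newton-const n)))
      where
      newton-const : ∀ n → newton (c ∷ []) n ≡ c
      newton-const zero    = refl
      newton-const (suc n) = trans (ℚₚ.+-identityʳ _) (newton-const n)

    -- A term `q(n) bⁿ` answers the term `p(n) bⁿ` when `b q(n+1) = d q(n) + p(n)`, so the bases
    -- decouple.
    newtonExpSum-recurrence : ∀ d (p : Fin K → List ℚ) → ∃ λ (q : Fin K → List ℚ) → ∀ n →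
      newtonExpSum q (suc n) ≡ fromℕ d * newtonExpSum q n + newtonExpSum p n
    newtonExpSum-recurrence d p = (λ i → proj₁ (solved i)) , λ n → begin
      newtonExpSum (λ i → proj₁ (solved i)) (suc n)
        ≡⟨ sum-cong-≗ (term n) ⟩
      sum (λ i → fromℕ d * (newton (proj₁ (solved i)) n * fromℕ (suc (toℕ i) ^ n))
               + newton (p i) n * fromℕ (suc (toℕ i) ^ n))
        ≡⟨ ∑-distrib-+ (λ i → fromℕ d * (newton (proj₁ (solved i)) n * fromℕ (suc (toℕ i) ^ n))) _ ⟩
      sum (λ i → fromℕ d * (newton (proj₁ (solved i)) n * fromℕ (suc (toℕ i) ^ n))) + newtonExpSum p n
        ≡⟨ cong (_+ newtonExpSum p n)
             (*-distribˡ-sum (fromℕ d) (λ i → newton (proj₁ (solved i)) n * fromℕ (suc (toℕ i) ^ n))) ⟨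
      fromℕ d * newtonExpSum (λ i → proj₁ (solved i)) n + newtonExpSum p n ∎
      where
      open ≡-Reasoning
      open +-*-Solver
      solved : ∀ i → _
      solved i = newton-recurrence (suc (toℕ i)) d (λ ()) (p i)
      term : ∀ n i → newton (proj₁ (solved i)) (suc n) * fromℕ (suc (toℕ i) ^ suc n) ≡
        fromℕ d * (newton (proj₁ (solved i)) n * fromℕ (suc (toℕ i) ^ n))
          + newton (p i) n * fromℕ (suc (toℕ i) ^ n)
      term n i = begin
        q′ * fromℕ (suc (toℕ i) ^ suc n)
          ≡⟨ cong (q′ *_) (fromℕ-* (suc (toℕ i)) (suc (toℕ i) ^ n)) ⟩
        q′ * (b * bⁿ)
          ≡⟨ solve 3 (λ q b x → q :* (b :* x) := (b :* q) :* x) refl q′ b bⁿ ⟩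
        (b * q′) * bⁿ
          ≡⟨ cong (_* bⁿ) (proj₂ (solved i) n) ⟩
        (fromℕ d * q + newton (p i) n) * bⁿ
          ≡⟨ solve 4 (λ d q p x → (d :* q :+ p) :* x := d :* (q :* x) :+ p :* x) refl
               (fromℕ d) q (newton (p i) n) bⁿ ⟩
        fromℕ d * (q * bⁿ) + newton (p i) n * bⁿ ∎
        where
        q  = newton (proj₁ (solved i)) n
        q′ = newton (proj₁ (solved i)) (suc n)
        b  = fromℕ (suc (toℕ i))
        bⁿ = fromℕ (suc (toℕ i) ^ n)

    -- Beyond `N`, the difference between `a` and a particular solution `q` solves the homogeneous
    -- recurrence, hence is a multiple of `dⁿ` if `d` is positive. The bound `d ≤ K` makes such a
    -- `d` one of the available bases.
    expPoly-recurrence : ∀ {a g} d → d ≤ K → EventuallyExpPoly K g →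
      (∀ n → a (suc n) ≡ d ℕ.* a n ℕ.+ g n) → EventuallyExpPoly K a
    expPoly-recurrence {a} {g} d d≤K (eventually p N g-eq) a-rec
      = finish d d≤K step (proj₂ solved)
      where
      open ≡-Reasoning
      open +-*-Solver
      solved = newtonExpSum-recurrence d p
      q : Fin K → List ℚ
      q = proj₁ solved
      step : ∀ n → n ≥ N → fromℕ (a (suc n)) ≡ fromℕ d * fromℕ (a n) + newtonExpSum p n
      step n n≥N = begin
        fromℕ (a (suc n))                     ≡⟨ cong fromℕ (a-rec n) ⟩
        fromℕ (d ℕ.* a n ℕ.+ g n)             ≡⟨ fromℕ-+ (d ℕ.* a n) (g n) ⟩
        fromℕ (d ℕ.* a n) + fromℕ (g n)       ≡⟨ cong₂ _+_ (fromℕ-* d (a n)) (g-eq n n≥N) ⟩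
        fromℕ d * fromℕ (a n) + newtonExpSum p n ∎

      finish : ∀ d → d ≤ K →
        (∀ n → n ≥ N → fromℕ (a (suc n)) ≡ fromℕ d * fromℕ (a n) + newtonExpSum p n) →
        (∀ n → newtonExpSum q (suc n) ≡ fromℕ d * newtonExpSum q n + newtonExpSum p n) →
        EventuallyExpPoly K a
      -- The homogeneous solution dies after one step; the value at `N` itself is unconstrained, so
      -- the threshold moves to `suc N`.
      finish zero d≤K a-step q-step = eventually q (suc N) eq
        where
        eq : ∀ n → n ≥ suc N → fromℕ (a n) ≡ newtonExpSum q n
        eq (suc n) (s≤s n≥N) = begin
          fromℕ (a (suc n))
            ≡⟨ a-step n n≥N ⟩
          0ℚ * fromℕ (a n) + newtonExpSum p n
            ≡⟨ cong (_+ newtonExpSum p n) (trans (ℚₚ.*-zeroˡ (fromℕ (a n))) (sym (ℚₚ.*-zeroˡ (newtonExpSum q n)))) ⟩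
          0ℚ * newtonExpSum q n + newtonExpSum p n
            ≡⟨ q-step n ⟨
          newtonExpSum q (suc n) ∎
      finish d@(suc d-1) d≤K a-step q-step = eventually (λ i → q i ⊞ δ i) N λ n n≥N →
        subst (λ n → fromℕ (a n) ≡ newtonExpSum (λ i → q i ⊞ δ i) n) (ℕₚ.m∸n+n≡m n≥N) (begin
          fromℕ (a (n ℕ.∸ N ℕ.+ N))                    ≡⟨ eq (n ℕ.∸ N) ⟩
          newtonExpSum q (n ℕ.∸ N ℕ.+ N) + C * fromℕ (d ^ (n ℕ.∸ N ℕ.+ N))
            ≡⟨ cong (newtonExpSum q (n ℕ.∸ N ℕ.+ N) +_) (sum-δ (n ℕ.∸ N ℕ.+ N)) ⟨
          newtonExpSum q (n ℕ.∸ N ℕ.+ N) + newtonExpSum δ (n ℕ.∸ N ℕ.+ N)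
            ≡⟨ newtonExpSum-⊞ q δ (n ℕ.∸ N ℕ.+ N) ⟨
          newtonExpSum (λ i → q i ⊞ δ i) (n ℕ.∸ N ℕ.+ N) ∎)
        where
        i₀ = fromℕ< d≤K
        d^N-inverse = fromℕ-invertible (d ^ N) (ℕ.≢-nonZero⁻¹ (d ^ N) {{ℕₚ.m^n≢0 d N}})
        -- Chosen so that `q` plus `C dⁿ` takes the value of `a` at `n = N`.
        C : ℚ
        C = (fromℕ (a N) - newtonExpSum q N) * proj₁ d^N-inverse
        δ : Fin K → List ℚ
        δ = single i₀ C
        sum-δ : ∀ n → newtonExpSum δ n ≡ C * fromℕ (d ^ n)
        sum-δ n = trans (newtonExpSum-single i₀ C n)
                        (cong (λ e → C * fromℕ (suc e ^ n)) (Finₚ.toℕ-fromℕ< d≤K))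
        eq : ∀ k → fromℕ (a (k ℕ.+ N)) ≡ newtonExpSum q (k ℕ.+ N) + C * fromℕ (d ^ (k ℕ.+ N))
        eq zero = begin
          x                       ≡⟨ solve 2 (λ x y → x := y :+ (x :- y) :* con 1ℚ) refl x y ⟩
          y + (x - y) * 1ℚ        ≡⟨ cong (λ z → y + (x - y) * z) (proj₂ d^N-inverse) ⟨
          y + (x - y) * (proj₁ d^N-inverse * fromℕ (d ^ N))
            ≡⟨ cong (y +_) (ℚₚ.*-assoc (x - y) (proj₁ d^N-inverse) (fromℕ (d ^ N))) ⟨
          y + C * fromℕ (d ^ N)   ∎
          where
          x = fromℕ (a N)
          y = newtonExpSum q N
        eq (suc k) = begin
          fromℕ (a (suc n))
            ≡⟨ a-step n (ℕₚ.m≤n+m N k) ⟩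
          D * fromℕ (a n) + P
            ≡⟨ cong (λ z → D * z + P) (eq k) ⟩
          D * (newtonExpSum q n + C * fromℕ (d ^ n)) + P
            ≡⟨ solve 5 (λ d q c x p → d :* (q :+ c :* x) :+ p := (d :* q :+ p) :+ c :* (d :* x)) refl
                 D (newtonExpSum q n) C (fromℕ (d ^ n)) P ⟩
          (D * newtonExpSum q n + P) + C * (D * fromℕ (d ^ n))
            ≡⟨ cong₂ (λ x y → x + C * y) (q-step n) (fromℕ-* d (d ^ n)) ⟨
          newtonExpSum q (suc n) + C * fromℕ (d ^ suc n) ∎
          where
          n = k ℕ.+ N
          D = fromℕ d
          P = newtonExpSum p n

  -- From Newton's basis to coefficient lists.

  binomial : ℕ → ℕ → ℚ
  binomial n       zero    = 1ℚ
  binomial zero    (suc j) = 0ℚ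
  binomial (suc n) (suc j) = binomial n (suc j) + binomial n j

  -- Dividing by `j + 1` gives each binomial as a linear factor in `n` times the previous one, which
  -- is the induction behind `binomial-isPolynomial`.
  binomial-absorption : ∀ n j →
    fromℕ (suc j) * binomial n (suc j) ≡ (fromℕ n - fromℕ j) * binomial n j
  binomial-absorption zero zero = refl
  binomial-absorption zero (suc j) =
    trans (ℚₚ.*-zeroʳ (fromℕ (suc (suc j)))) (sym (ℚₚ.*-zeroʳ (0ℚ - fromℕ (suc j))))
  binomial-absorption (suc n) zero = begin
    1ℚ * (binomial n 1 + 1ℚ)          ≡⟨ ℚₚ.*-distribˡ-+ 1ℚ (binomial n 1) 1ℚ ⟩
    1ℚ * binomial n 1 + 1ℚ * 1ℚ       ≡⟨ cong (_+ 1ℚ * 1ℚ) (binomial-absorption n zero) ⟩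
    (fromℕ n - 0ℚ) * 1ℚ + 1ℚ * 1ℚ
      ≡⟨ solve 1 (λ x → (x :- con 0ℚ) :* con 1ℚ :+ con 1ℚ :* con 1ℚ :=
                        ((con 1ℚ :+ x) :- con 0ℚ) :* con 1ℚ) refl (fromℕ n) ⟩
    ((1ℚ + fromℕ n) - 0ℚ) * 1ℚ        ≡⟨ cong (λ z → (z - 0ℚ) * 1ℚ) (fromℕ-suc n) ⟨
    (fromℕ (suc n) - 0ℚ) * 1ℚ         ∎
    where
    open ≡-Reasoning
    open +-*-Solver
  binomial-absorption (suc n) (suc j) = begin
    fromℕ (2 ℕ.+ j) * (x + y)               ≡⟨ ℚₚ.*-distribˡ-+ (fromℕ (2 ℕ.+ j)) x y ⟩
    fromℕ (2 ℕ.+ j) * x + fromℕ (2 ℕ.+ j) * y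
      ≡⟨ cong₂ (λ u v → u + v * y) (binomial-absorption n (suc j)) (fromℕ-suc (suc j)) ⟩
    (N - J) * y + (1ℚ + J) * y
      ≡⟨ solve 3 (λ n j y → (n :- j) :* y :+ (con 1ℚ :+ j) :* y := (con 1ℚ :+ n :- j) :* y :+ j :* y) refl N J y ⟩
    (1ℚ + N - J) * y + J * y
      ≡⟨ cong ((1ℚ + N - J) * y +_) (binomial-absorption n j) ⟩
    (1ℚ + N - J) * y + (N - fromℕ j) * z
      ≡⟨ cong (λ u → (1ℚ + N - J) * y + u * z) (shift N (fromℕ j) J (fromℕ-suc j)) ⟩
    (1ℚ + N - J) * y + (1ℚ + N - J) * z     ≡⟨ ℚₚ.*-distribˡ-+ (1ℚ + N - J) y z ⟨
    (1ℚ + N - J) * (y + z)                  ≡⟨ cong (λ u → (u - J) * (y + z)) (fromℕ-suc n) ⟨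
    (fromℕ (suc n) - J) * (y + z)           ∎
    where
    open ≡-Reasoning
    open +-*-Solver
    x = binomial n (2 ℕ.+ j)
    y = binomial n (suc j)
    z = binomial n j
    N = fromℕ n
    J = fromℕ (suc j)
    shift : ∀ n i j → j ≡ 1ℚ + i → n - i ≡ 1ℚ + n - j
    shift n i _ refl = solve 2 (λ n i → n :- i := con 1ℚ :+ n :- (con 1ℚ :+ i)) refl n i

  IsPolynomial : (ℕ → ℚ) → Set
  IsPolynomial f = ∃ λ p → ∀ n → eval p (fromℕ n) ≡ f n

  isPolynomial-+ : ∀ {f g} → IsPolynomial f → IsPolynomial g → IsPolynomial (λ n → f n + g n)
  isPolynomial-+ (p , p≗f) (q , q≗g) =
    p ⊞ q , λ n → trans (eval-⊞ p q (fromℕ n)) (cong₂ _+_ (p≗f n) (q≗g n))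
    where
    open +-*-Solver
    eval-⊞ : ∀ p q x → eval (p ⊞ q) x ≡ eval p x + eval q x
    eval-⊞ []      q       x = sym (ℚₚ.+-identityˡ _)
    eval-⊞ (c ∷ p) []      x = sym (ℚₚ.+-identityʳ _)
    eval-⊞ (c ∷ p) (d ∷ q) x = trans (cong (λ z → c + d + x * z) (eval-⊞ p q x))
      (solve 5 (λ c d x p q → c :+ d :+ x :* (p :+ q) := (c :+ x :* p) :+ (d :+ x :* q)) refl
         c d x (eval p x) (eval q x))

  isPolynomial-scale : ∀ {f} r → IsPolynomial f → IsPolynomial (λ n → r * f n)
  isPolynomial-scale r (p , p≗f) =
    List.map (r *_) p , λ n → trans (eval-map-* p (fromℕ n)) (cong (r *_) (p≗f n))
    where
    open +-*-Solver
    eval-map-* : ∀ p x → eval (List.map (r *_) p) x ≡ r * eval p x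
    eval-map-* []      x = sym (ℚₚ.*-zeroʳ r)
    eval-map-* (c ∷ p) x = trans (cong (λ z → r * c + x * z) (eval-map-* p x))
      (solve 4 (λ r c x p → r :* c :+ x :* (r :* p) := r :* (c :+ x :* p)) refl r c x (eval p x))

  isPolynomial-shift : ∀ {f} → IsPolynomial f → IsPolynomial (λ n → fromℕ n * f n)
  isPolynomial-shift (p , p≗f) =
    0ℚ ∷ p , λ n → trans (ℚₚ.+-identityˡ _) (cong (fromℕ n *_) (p≗f n))

  isPolynomial-cong : ∀ {f g} → (∀ n → f n ≡ g n) → IsPolynomial f → IsPolynomial g
  isPolynomial-cong f≗g (p , p≗f) = p , λ n → trans (p≗f n) (f≗g n)

  binomial-isPolynomial : ∀ j → IsPolynomial (λ n → binomial n j)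
  binomial-isPolynomial zero    = 1ℚ ∷ [] , λ n → trans (cong (1ℚ +_) (ℚₚ.*-zeroʳ (fromℕ n))) refl
  binomial-isPolynomial (suc j) = isPolynomial-cong
    (λ n → begin
      1/J * (fromℕ n * binomial n j + - fromℕ j * binomial n j)
        ≡⟨ cong (1/J *_) (ℚₚ.*-distribʳ-+ (binomial n j) (fromℕ n) (- fromℕ j)) ⟨
      1/J * ((fromℕ n - fromℕ j) * binomial n j)   ≡⟨ cong (1/J *_) (binomial-absorption n j) ⟨
      1/J * (J * binomial n (suc j))               ≡⟨ ℚₚ.*-assoc 1/J J _ ⟨
      1/J * J * binomial n (suc j)                 ≡⟨ cong (_* binomial n (suc j)) (proj₂ (fromℕ-invertible (suc j) λ ())) ⟩
      1ℚ * binomial n (suc j)                       ≡⟨ ℚₚ.*-identityˡ _ ⟩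
      binomial n (suc j)                            ∎)
    (isPolynomial-scale 1/J
      (isPolynomial-+ (isPolynomial-shift (binomial-isPolynomial j))
                      (isPolynomial-scale (- fromℕ j) (binomial-isPolynomial j))))
    where
    open ≡-Reasoning
    J = fromℕ (suc j)
    1/J = proj₁ (fromℕ-invertible (suc j) λ ())

  binomialSum : ℕ → List ℚ → ℕ → ℚ
  binomialSum j []       n = 0ℚ
  binomialSum j (c ∷ cs) n = c * binomial n j + binomialSum (suc j) cs n

  newton-binomialSum : ∀ cs n → newton cs n ≡ binomialSum 0 cs n
  newton-binomialSum []       n       = refl
  newton-binomialSum (c ∷ cs) zero    =
    sym (trans (cong (c * 1ℚ +_) (at-zero 0 cs)) (trans (ℚₚ.+-identityʳ _) (ℚₚ.*-identityʳ c)))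
    where
    at-zero : ∀ j cs → binomialSum (suc j) cs 0 ≡ 0ℚ
    at-zero j []       = refl
    at-zero j (c ∷ cs) = trans (cong₂ _+_ (ℚₚ.*-zeroʳ c) (at-zero (suc j) cs)) refl
  newton-binomialSum (c ∷ cs) (suc n) = begin
    newton (c ∷ cs) n + newton cs n
      ≡⟨ cong₂ _+_ (newton-binomialSum (c ∷ cs) n) (newton-binomialSum cs n) ⟩
    (c * 1ℚ + binomialSum 1 cs n) + binomialSum 0 cs n
      ≡⟨ ℚₚ.+-assoc (c * 1ℚ) (binomialSum 1 cs n) _ ⟩
    c * 1ℚ + (binomialSum 1 cs n + binomialSum 0 cs n)
      ≡⟨ cong (c * 1ℚ +_) (pascal 0 cs) ⟨
    c * 1ℚ + binomialSum 1 cs (suc n) ∎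
    where
    open ≡-Reasoning
    open +-*-Solver
    pascal : ∀ j cs → binomialSum (suc j) cs (suc n) ≡ binomialSum (suc j) cs n + binomialSum j cs n
    pascal j []       = refl
    pascal j (c ∷ cs) = trans (cong (c * binomial (suc n) (suc j) +_) (pascal (suc j) cs))
      (solve 5 (λ c x y p q → c :* (x :+ y) :+ (p :+ q) := (c :* x :+ p) :+ (c :* y :+ q)) refl
         c (binomial n (suc j)) (binomial n j) (binomialSum (suc (suc j)) cs n) (binomialSum (suc j) cs n))

  newton-isPolynomial : ∀ cs → IsPolynomial (newton cs)
  newton-isPolynomial cs = isPolynomial-cong (λ n → sym (newton-binomialSum cs n)) (go 0 cs)
    where
    go : ∀ j cs → IsPolynomial (binomialSum j cs)
    go j []       = [] , λ _ → refl
    go j (c ∷ cs) = isPolynomial-+ (isPolynomial-scale c (binomial-isPolynomial j)) (go (suc j) cs)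

  newtonExpSum⇒polyExpSum : ∀ {K} (p : Fin K → List ℚ) →
    Σ (Fin K → Polynomial) λ q → ∀ n → newtonExpSum p n ≡ polyExpSum q n
  newtonExpSum⇒polyExpSum p = (λ i → proj₁ (newton-isPolynomial (p i))) ,
    λ n → sum-cong-≗ λ i → cong (_* fromℕ (suc (toℕ i) ^ n)) (sym (proj₂ (newton-isPolynomial (p i)) n))

open ExponentialPolynomials
open import Data.Nat.Base using (_+_; _*_; _∸_; _⊓_; _⊔_)
open import Data.Nat.Solver using (module +-*-Solver)

-- Finite enumerations.

allVecs : {A : Set} → List A → ∀ n → List (Vec A n)
allVecs xs zero    = [] ∷ []
allVecs xs (suc n) = cartesianProductWith _∷_ xs (allVecs xs n)

module _ {A : Set} {xs : List A} where

  ∈-allVecs : (∀ x → x ∈ xs) → ∀ {n} (v : Vec A n) → v ∈ allVecs xs n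
  ∈-allVecs ∈xs []      = here refl
  ∈-allVecs ∈xs (x ∷ v) = ∈ₚ.∈-cartesianProductWith⁺ _∷_ (∈xs x) (∈-allVecs ∈xs v)

  allVecs-unique : Unique xs → ∀ n → Unique (allVecs xs n)
  allVecs-unique xs! zero    = [] ∷ []
  allVecs-unique xs! (suc n) =
    Uniqueₚ.cartesianProductWith⁺ _∷_ Vecₚ.∷-injective xs! (allVecs-unique xs! n)

uniform-bound : {A : Set} {ℓ : Level} (P : A → ℕ → Set ℓ) → (∀ {x m n} → m ≤ n → P x m → P x n) →
  ∀ xs → (∀ x → x ∈ xs → ∃ (P x)) → ∃ λ n → ∀ x → x ∈ xs → P x n
uniform-bound P P-mono []       bound = 0 , λ _ ()
uniform-bound P P-mono (x ∷ xs) bound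
  with m , Pm ← bound x (here refl)
  with n , Pn ← uniform-bound P P-mono xs (λ y → bound y ∘ there)
  = m ⊔ n , λ where
      _ (here refl)  → P-mono (ℕₚ.m≤m⊔n m n) Pm
      y (there y∈xs) → P-mono (ℕₚ.m≤n⊔m m n) (Pn y y∈xs)

-- Letter counts of words

infix 4 _⊑_

-- A letter is absent on one side exactly when it is absent on the other. So a word with counts `u`
-- embeds into one with counts `v`, and the image meets every colour of the larger word.
_⊑_ : {k : ℕ} → (Fin k → ℕ) → (Fin k → ℕ) → Set
u ⊑ v = ∀ i → u i ≡ v i ⊎ (2 ≤ u i × u i ≤ v i)

-- Equality of min(u i, B) and min(v i, B), stated without minima.
AgreeBelow : ℕ → {k : ℕ} → (Fin k → ℕ) → (Fin k → ℕ) → Set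
AgreeBelow B u v = ∀ i → u i ≡ v i ⊎ (B ≤ u i × B ≤ v i)

⊑-trans : ∀ {k} {u v w : Fin k → ℕ} → u ⊑ v → v ⊑ w → u ⊑ w
⊑-trans u⊑v v⊑w i with u⊑v i | v⊑w i
... | inj₁ u≡v         | inj₁ v≡w         = inj₁ (trans u≡v v≡w)
... | inj₁ u≡v         | inj₂ (2≤v , v≤w) =
  inj₂ (subst (2 ≤_) (sym u≡v) 2≤v , subst (_≤ _) (sym u≡v) v≤w)
... | inj₂ (2≤u , u≤v) | inj₁ v≡w         = inj₂ (2≤u , subst (_ ≤_) v≡w u≤v)
... | inj₂ (2≤u , u≤v) | inj₂ (2≤v , v≤w) = inj₂ (2≤u , ℕₚ.≤-trans u≤v v≤w)

⊑⇒≤ : ∀ {k} {u v : Fin k → ℕ} → u ⊑ v → ∀ i → u i ≤ v i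
⊑⇒≤ u⊑v i = [ ℕₚ.≤-reflexive , proj₂ ]′ (u⊑v i)

⊑-reflects-occurrence : ∀ {k} {u v : Fin k → ℕ} → u ⊑ v → ∀ i → 1 ≤ v i → 1 ≤ u i
⊑-reflects-occurrence u⊑v i 1≤v with u⊑v i
... | inj₁ u≡v       = subst (1 ≤_) (sym u≡v) 1≤v
... | inj₂ (2≤u , _) = ℕₚ.≤-trans (s≤s z≤n) 2≤u

agree-sym : ∀ {B k} {u v : Fin k → ℕ} → AgreeBelow B u v → AgreeBelow B v u
agree-sym u≈v i = [ inj₁ ∘ sym , (λ (B≤u , B≤v) → inj₂ (B≤v , B≤u)) ]′ (u≈v i)

agree-trans : ∀ {B k} {u v w : Fin k → ℕ} → AgreeBelow B u v → AgreeBelow B v w → AgreeBelow B u w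
agree-trans u≈v v≈w i with u≈v i | v≈w i
... | inj₁ u≡v         | inj₁ v≡w         = inj₁ (trans u≡v v≡w)
... | inj₁ u≡v         | inj₂ (B≤v , B≤w) = inj₂ (subst (_ ≤_) (sym u≡v) B≤v , B≤w)
... | inj₂ (B≤u , B≤v) | inj₁ v≡w         = inj₂ (B≤u , subst (_ ≤_) v≡w B≤v)
... | inj₂ (B≤u , _)   | inj₂ (_ , B≤w)   = inj₂ (B≤u , B≤w)

agree-weaken : ∀ {B C k} {u v : Fin k → ℕ} → B ≤ C → AgreeBelow C u v → AgreeBelow B u v
agree-weaken B≤C u≈v i = [ inj₁ , (λ (C≤u , C≤v) → inj₂ (ℕₚ.≤-trans B≤C C≤u , ℕₚ.≤-trans B≤C C≤v)) ]′ (u≈v i)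

δ : {k : ℕ} → Fin k → Fin k → ℕ
δ i j = if does (i Finₚ.≟ j) then 1 else 0

δ-refl : ∀ {k} (i : Fin k) → δ i i ≡ 1
δ-refl i = cong (if_then 1 else 0) (dec-true (i Finₚ.≟ i) refl)

count : {k n : ℕ} → Vec (Fin k) n → Fin k → ℕ
count []      j = 0
count (i ∷ w) j = δ i j + count w j

count-lookup : ∀ {k n} (w : Vec (Fin k) n) a → 1 ≤ count w (lookup w a)
count-lookup (i ∷ w) zero    = subst (λ d → 1 ≤ d + count w i) (sym (δ-refl i)) (s≤s z≤n)
count-lookup (i ∷ w) (suc a) = ℕₚ.≤-trans (count-lookup w a) (ℕₚ.m≤n+m _ (δ i _))

count⇒lookup : ∀ {k n} (w : Vec (Fin k) n) j → 1 ≤ count w j → ∃ λ a → lookup w a ≡ j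
count⇒lookup (i ∷ w) j 1≤ with i Finₚ.≟ j
... | yes i≡j = zero , i≡j
... | no  _   = let a , eq = count⇒lookup w j 1≤ in suc a , eq

count-removeAt : ∀ {k n} (w : Vec (Fin k) (suc n)) p j →
  count w j ≡ δ (lookup w p) j + count (removeAt w p) j
count-removeAt (i ∷ w)       zero    j = refl
count-removeAt (i ∷ w@(_ ∷ _)) (suc p) j = trans (cong (δ i j +_) (count-removeAt w p j))
  (solve 3 (λ x y z → x :+ (y :+ z) := y :+ (x :+ z)) refl
    (δ i j) (δ (lookup w p) j) (count (removeAt w p) j))
  where
  open +-*-Solver

lookup-removeAt : ∀ {k n} (w : Vec (Fin k) (suc n)) p a → lookup (removeAt w p) a ≡ lookup w (punchIn p a)
lookup-removeAt (i ∷ w)         zero    a       = refl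
lookup-removeAt (i ∷ w@(_ ∷ _)) (suc p) zero    = refl
lookup-removeAt (i ∷ w@(_ ∷ _)) (suc p) (suc a) = lookup-removeAt w p a

-- Greedy: match the first letter with any position of its colour and delete that position. Both
-- counts drop by the same `δ c`, so the hypothesis survives; `punchIn` keeps later images away from
-- `p`.
embedding : ∀ {k m n} (u : Vec (Fin k) m) (w : Vec (Fin k) n) → (∀ j → count u j ≤ count w j) →
  ∃ λ (g : Fin m → Fin n) → Injective _≡_ _≡_ g × (∀ a → lookup w (g a) ≡ lookup u a)
embedding []      w u≤w = (λ ()) , (λ { {()} }) , λ ()
embedding {n = zero} (c ∷ u) [] u≤w =
  contradiction (ℕₚ.≤-trans (count-lookup (c ∷ u) zero) (u≤w c)) λ ()
embedding {n = suc n} (c ∷ u) w u≤w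
  with p , eq ← count⇒lookup w c (ℕₚ.≤-trans (count-lookup (c ∷ u) zero) (u≤w c))
  with g , g-inj , g-col ← embedding u (removeAt w p) (λ j → ℕₚ.+-cancelˡ-≤ (δ c j) _ _
         (subst (δ c j + count u j ≤_)
           (trans (count-removeAt w p j) (cong (λ i → δ i j + count (removeAt w p) j) eq)) (u≤w j)))
  = h , h-inj , h-col
  where
  h : Fin (suc _) → Fin (suc n)
  h zero    = p
  h (suc a) = punchIn p (g a)
  h-inj : Injective _≡_ _≡_ h
  h-inj {zero}  {zero}  _  = refl
  h-inj {zero}  {suc b} eq = contradiction (sym eq) (Finₚ.punchInᵢ≢i p (g b))
  h-inj {suc a} {zero}  eq = contradiction eq (Finₚ.punchInᵢ≢i p (g a))
  h-inj {suc a} {suc b} eq = cong suc (g-inj (Finₚ.punchIn-injective p (g a) (g b) eq))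
  h-col : ∀ a → lookup w (h a) ≡ lookup (c ∷ u) a
  h-col zero    = eq
  h-col (suc a) = trans (sym (lookup-removeAt w p (g a))) (g-col a)

module _ {n : ℕ} (i j : Fin n) where

  transpose-left : transpose i j i ≡ j
  transpose-left rewrite dec-true (i Finₚ.≟ i) refl = refl

  transpose-right : transpose i j j ≡ i
  transpose-right with j Finₚ.≟ i
  ... | yes j≡i = j≡i
  ... | no  _ rewrite dec-true (j Finₚ.≟ j) refl = refl

  transpose-other : ∀ {x} → x ≢ i → x ≢ j → transpose i j x ≡ x
  transpose-other {x} x≢i x≢j
    rewrite dec-false (x Finₚ.≟ i) x≢i | dec-false (x Finₚ.≟ j) x≢j = refl

  transpose-involutive : ∀ x → transpose i j (transpose i j x) ≡ x
  transpose-involutive x with x Finₚ.≟ i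
  ... | yes refl = transpose-right
  ... | no  x≢i with x Finₚ.≟ j
  ...   | yes refl = transpose-left
  ...   | no  x≢j  = transpose-other x≢i x≢j

  transpose-injective : Injective _≡_ _≡_ (transpose i j)
  transpose-injective {x} {y} eq = trans (sym (transpose-involutive x))
    (trans (cong (transpose i j) eq) (transpose-involutive y))

-- Restricted growth words

module _ {k : ℕ} where

  step : Fin k → (Fin k → ℕ) → (Fin k → ℕ)
  step i s j = δ i j + s j

  Allowed : (Fin k → ℕ) → Fin k → Set
  Allowed s i = ∀ j → j Fin.< i → 1 ≤ s j

  -- New letters appear in increasing order, the letters j with 0 < s j counting as old.
  RestrictedGrowth : (Fin k → ℕ) → {n : ℕ} → Vec (Fin k) n → Set
  RestrictedGrowth s []      = ⊤
  RestrictedGrowth s (i ∷ w) = Allowed s i × RestrictedGrowth (step i s) w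

  step-self : ∀ i s → 1 ≤ step i s i
  step-self i s = subst (λ d → 1 ≤ d + s i) (sym (δ-refl i)) (s≤s z≤n)

  step-mono : ∀ i s j → 1 ≤ s j → 1 ≤ step i s j
  step-mono i s j 1≤s = ℕₚ.≤-trans 1≤s (ℕₚ.m≤n+m (s j) (δ i j))

  step-cases : ∀ i s j → 1 ≤ step i s j → i ≡ j ⊎ 1 ≤ s j
  step-cases i s j 1≤ with i Finₚ.≟ j
  ... | yes i≡j = inj₁ i≡j
  ... | no  _   = inj₂ 1≤

  -- If the first letters differ, the smaller one is already old because the larger one is allowed,
  -- and `old` then puts it at this position in both words. Once the first letters agree, that
  -- letter becomes old and `same` locates its further occurrences.
  restrictedGrowth-unique : ∀ s {n} (w w′ : Vec (Fin k) n) →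
    RestrictedGrowth s w → RestrictedGrowth s w′ →
    (∀ j → 1 ≤ s j → ∀ p → lookup w p ≡ j ⇔ lookup w′ p ≡ j) →
    (∀ p q → lookup w p ≡ lookup w q ⇔ lookup w′ p ≡ lookup w′ q) → w ≡ w′
  restrictedGrowth-unique s []      []        _  _  _   _    = refl
  restrictedGrowth-unique s (i ∷ w) (i′ ∷ w′) (i-ok , rg) (i′-ok , rg′) old same
    with Finₚ.<-cmp i i′
  ... | tri< i<i′ i≢i′ _ =
    contradiction (sym (Equivalence.to (old i (i′-ok i i<i′) zero) refl)) i≢i′
  ... | tri> _ i≢i′ i′<i =
    contradiction (Equivalence.from (old i′ (i-ok i′ i′<i) zero) refl) i≢i′
  ... | tri≈ _ refl _ = cong (i ∷_) (restrictedGrowth-unique (step i s) w w′ rg rg′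
    (λ j 1≤ p → [ (λ { refl → same (suc p) zero }) , (λ 1≤s → old j 1≤s (suc p)) ]′ (step-cases i s j 1≤))
    (λ p q → same (suc p) (suc q)))

  -- The last hypothesis says that the letters already read form an initial segment. A fresh letter
  -- `c` must become the least unread letter `i`; exchanging the two in the rest of the word leaves
  -- old letters fixed, so the recursion can continue.
  restrictedGrowth-exists : ∀ n s (w : Vec (Fin k) n) → (∀ j → 1 ≤ s j → Allowed s j) →
    ∃ λ (π : Fin k → Fin k) →
      Injective _≡_ _≡_ π × (∀ j → 1 ≤ s j → π j ≡ j) × RestrictedGrowth s (Vec.map π w)
  restrictedGrowth-exists zero    s []      initial = (λ j → j) , (λ eq → eq) , (λ _ _ → refl) , tt
  restrictedGrowth-exists (suc n) s (c ∷ w) initial with 1 ℕₚ.≤? s c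
  ... | yes 1≤sc =
    let π , π-inj , π-fix , rg = restrictedGrowth-exists n (step c s) w (step-initial c (initial c 1≤sc))
    in π , π-inj , (λ j 1≤s → π-fix j (step-mono c s j 1≤s)) ,
       subst (λ d → RestrictedGrowth s (d ∷ Vec.map π w)) (sym (π-fix c (step-self c s)))
         (initial c 1≤sc , rg)
    where
    step-initial : ∀ i → Allowed s i → ∀ j → 1 ≤ step i s j → Allowed (step i s) j
    step-initial i i-ok j 1≤ j′ j′<j = step-mono i s j′
      ([ (λ { refl → i-ok j′ j′<j }) , (λ 1≤s → initial j 1≤s j′ j′<j) ]′ (step-cases i s j 1≤))
  ... | no 1≰sc
    with i , 1≰si , below ← Finₚ.¬∀⟶∃¬-smallest k (λ j → 1 ≤ s j) (λ j → 1 ℕₚ.≤? s j) (λ all → 1≰sc (all c))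
    = extend (restrictedGrowth-exists n (step i s) (Vec.map (transpose c i) w) step-initial)
    where
    i-ok : Allowed s i
    i-ok j j<i = subst (λ j → 1 ≤ s j) (Finₚ.toℕ-injective
      (trans (Finₚ.toℕ-inject (fromℕ< j<i)) (Finₚ.toℕ-fromℕ< j<i))) (below (fromℕ< j<i))
    step-initial : ∀ j → 1 ≤ step i s j → Allowed (step i s) j
    step-initial j 1≤ j′ j′<j = step-mono i s j′
      ([ (λ { refl → i-ok j′ j′<j }) , (λ 1≤s → initial j 1≤s j′ j′<j) ]′ (step-cases i s j 1≤))
    extend : (∃ λ (π : Fin k → Fin k) → Injective _≡_ _≡_ π × (∀ j → 1 ≤ step i s j → π j ≡ j) ×
                RestrictedGrowth (step i s) (Vec.map π (Vec.map (transpose c i) w))) →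
             ∃ λ (π : Fin k → Fin k) → Injective _≡_ _≡_ π × (∀ j → 1 ≤ s j → π j ≡ j) ×
                RestrictedGrowth s (Vec.map π (c ∷ w))
    extend (π , π-inj , π-fix , rg) =
      π ∘ transpose c i ,
      transpose-injective c i ∘ π-inj ,
      (λ j 1≤s → trans (cong π (transpose-other c i (λ { refl → 1≰sc 1≤s }) (λ { refl → 1≰si 1≤s })))
                       (π-fix j (step-mono i s j 1≤s))) ,
      subst (Allowed s) (sym πτc≡i) i-ok ,
      subst (λ j → RestrictedGrowth (step j s) (Vec.map (π ∘ transpose c i) w)) (sym πτc≡i)
        (subst (RestrictedGrowth (step i s)) (sym (Vecₚ.map-∘ π (transpose c i) w)) rg)
      where
      πτc≡i : π (transpose c i c) ≡ i
      πτc≡i = trans (cong π (transpose-left c i)) (π-fix i (step-self i s))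

expPoly-letters : {A : Set} {K : ℕ} {a : ℕ → ℕ} (b : A → ℕ → ℕ) (xs : List A) →
  (∀ x → (∀ n → b x n ≡ a n) ⊎ EventuallyExpPoly K (b x)) →
  ∃ λ d → d ≤ length xs × ∃ λ g → EventuallyExpPoly K g ×
    (∀ n → listSum (List.map (λ x → b x n) xs) ≡ d * a n + g n)
expPoly-letters b []       cases = 0 , z≤n , (λ _ → 0) , expPoly-0 , λ _ → refl
expPoly-letters {a = a} b (x ∷ xs) cases with expPoly-letters b xs cases | cases x
... | d , d≤ , g , g-exp , eq | inj₁ b≗a =
  suc d , s≤s d≤ , g , g-exp , λ n →
    trans (cong₂ _+_ (b≗a n) (eq n)) (sym (ℕₚ.+-assoc (a n) (d * a n) (g n)))
... | d , d≤ , g , g-exp , eq | inj₂ b-exp =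
  d , ℕₚ.m≤n⇒m≤1+n d≤ , (λ n → b x n + g n) , expPoly-+ b-exp g-exp , λ n →
    trans (cong (b x n +_) (eq n))
      (solve 3 (λ x y z → x :+ (y :+ z) := y :+ (x :+ z)) refl (b x n) (d * a n) (g n))
  where
  open +-*-Solver

expPoly-sum : {A : Set} {K : ℕ} (b : A → ℕ → ℕ) (xs : List A) →
  (∀ x → EventuallyExpPoly K (b x)) →
  EventuallyExpPoly K (λ n → listSum (List.map (λ x → b x n) xs))
expPoly-sum b []       b-exp = expPoly-0
expPoly-sum b (x ∷ xs) b-exp = expPoly-+ (b-exp x) (expPoly-sum b xs b-exp)

total : ∀ {k} → (Fin k → ℕ) → ℕ
total {zero}  f = 0
total {suc k} f = f zero + total (f ∘ suc)

total-mono-≤ : ∀ {k} {f g : Fin k → ℕ} → (∀ i → f i ≤ g i) → total f ≤ total g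
total-mono-≤ {zero}  f≤g = z≤n
total-mono-≤ {suc k} f≤g = ℕₚ.+-mono-≤ (f≤g zero) (total-mono-≤ (f≤g ∘ suc))

total-mono-< : ∀ {k} {f g : Fin k → ℕ} → (∀ i → f i ≤ g i) → ∀ i → f i < g i → total f < total g
total-mono-< f≤g zero    f<g = ℕₚ.+-mono-<-≤ f<g (total-mono-≤ (f≤g ∘ suc))
total-mono-< f≤g (suc i) f<g = ℕₚ.+-mono-≤-< (f≤g zero) (total-mono-< (f≤g ∘ suc) i f<g)

-- Dickson's lemma and the counting of accepted words.

module Classical (em : ∀ {ℓ} → ExcludedMiddle ℓ) where

  -- A form of Dickson's lemma: a predicate that persists when entries ≥ 2 grow
  -- does not distinguish large entries.
  ⊑-closed⇒agree-closed : ∀ k {ℓ} (P : (Fin k → ℕ) → Set ℓ) → (∀ {u v} → u ⊑ v → P u → P v) →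
    ∃ λ B → ∀ {u v} → AgreeBelow B u v → P u → P v
  ⊑-closed⇒agree-closed zero    P P-mono = 0 , λ _ → P-mono λ ()
  ⊑-closed⇒agree-closed (suc k) {ℓ} P P-mono = B , closed
    where
    cons-mono : ∀ {x u v} → u ⊑ v → P (x F.∷ u) → P (x F.∷ v)
    cons-mono u⊑v = P-mono λ { zero → inj₁ refl ; (suc i) → u⊑v i }

    head-mono : ∀ {x y u} → 2 ≤ x → x ≤ y → P (x F.∷ u) → P (y F.∷ u)
    head-mono 2≤x x≤y = P-mono λ { zero → inj₂ (2≤x , x≤y) ; (suc i) → inj₁ refl }

    -- By `head-mono` this says that `P` holds for all sufficiently large heads. It concerns the
    -- tail only, so the induction on `k` applies.
    P∞ : (Fin k → ℕ) → Set ℓ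
    P∞ u = ∃ λ x → 2 ≤ x × P (x F.∷ u)

    tails∞ : ∃ λ B → ∀ {u v} → AgreeBelow B u v → P∞ u → P∞ v
    tails∞ = ⊑-closed⇒agree-closed k P∞ λ u⊑v (x , 2≤x , Px) → x , 2≤x , cons-mono u⊑v Px
    B∞ = proj₁ tails∞

    -- P∞ v depends only on the truncation of v at C, for which there are finitely many values.
    C = 2 ⊔ B∞
    truncations : List (Vec (Fin (suc C)) k)
    truncations = allVecs (allFin (suc C)) k

    ⟦_⟧ : Vec (Fin (suc C)) k → Fin k → ℕ
    ⟦ e ⟧ i = toℕ (Vec.lookup e i)

    HeadBound : Vec (Fin (suc C)) k → ℕ → Set ℓ
    HeadBound e X = 2 ≤ X × (P∞ ⟦ e ⟧ → P (X F.∷ ⟦ e ⟧))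

    heads : ∃ λ X → ∀ e → e ∈ truncations → HeadBound e X
    heads = uniform-bound HeadBound
      (λ m≤n (2≤m , Pm) → ℕₚ.≤-trans 2≤m m≤n , head-mono 2≤m m≤n ∘ Pm)
      truncations bound
      where
      bound : ∀ e → e ∈ truncations → ∃ (HeadBound e)
      bound e _ with em {P = P∞ ⟦ e ⟧}
      ... | yes (x , 2≤x , Px) = x , 2≤x , λ _ → Px
      ... | no  ¬P∞            = 2 , ℕₚ.≤-refl , λ P∞e → contradiction P∞e ¬P∞
    X = proj₁ heads

    truncate : (Fin k → ℕ) → Vec (Fin (suc C)) k
    truncate v = Vec.tabulate λ i → fromℕ< (s≤s (ℕₚ.m⊓n≤m C (v i)))

    ⟦truncate⟧ : ∀ v i → ⟦ truncate v ⟧ i ≡ C ⊓ v i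
    ⟦truncate⟧ v i = trans (cong toℕ (Vecₚ.lookup∘tabulate _ i)) (Finₚ.toℕ-fromℕ< _)

    truncate-cases : ∀ v i → ⟦ truncate v ⟧ i ≡ v i ⊎ (C ≤ ⟦ truncate v ⟧ i × ⟦ truncate v ⟧ i ≤ v i)
    truncate-cases v i with ℕₚ.≤-total (v i) C
    ... | inj₁ v≤C = inj₁ (trans (⟦truncate⟧ v i) (ℕₚ.m≥n⇒m⊓n≡n v≤C))
    ... | inj₂ C≤v = inj₂ (ℕₚ.≤-reflexive (sym eq) , subst (_≤ v i) (sym eq) C≤v)
      where eq = trans (⟦truncate⟧ v i) (ℕₚ.m≤n⇒m⊓n≡m C≤v)

    -- `P∞` is carried from `v` to its truncation, where the head `X` is large enough; the truncated
    -- entries, being at least `C ≥ 2`, then grow back to those of `v`.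
    at-X : ∀ v → P∞ v → P (X F.∷ v)
    at-X v P∞v =
      cons-mono
        (λ i → [ inj₁ , (λ (C≤ , ≤v) → inj₂ (ℕₚ.≤-trans (ℕₚ.m≤m⊔n 2 B∞) C≤ , ≤v)) ]′ (truncate-cases v i))
        (proj₂ (proj₂ heads (truncate v) (∈-allVecs ∈ₚ.∈-allFin (truncate v)))
          (proj₂ tails∞
            (λ i → [ inj₁ ∘ sym , (λ (C≤ , ≤v) →
                let B∞≤ = ℕₚ.≤-trans (ℕₚ.m≤n⊔m 2 B∞) C≤ in inj₂ (ℕₚ.≤-trans B∞≤ ≤v , B∞≤)) ]′
              (truncate-cases v i))
            P∞v))

    2≤X : 2 ≤ X
    2≤X = proj₁ (proj₂ heads (truncate (λ _ → 0)) (∈-allVecs ∈ₚ.∈-allFin (truncate (λ _ → 0))))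

    TailBound : ℕ → ℕ → Set ℓ
    TailBound x B = ∀ {u v} → AgreeBelow B u v → P (x F.∷ u) → P (x F.∷ v)

    tails : ∃ λ B → ∀ x → x ∈ upTo X → TailBound x B
    tails = uniform-bound TailBound
      (λ m≤n closed u≈v → closed (agree-weaken m≤n u≈v)) (upTo X)
      (λ x _ → ⊑-closed⇒agree-closed k (λ u → P (x F.∷ u)) cons-mono)
    B₀ = proj₁ tails

    -- Heads below `X` give finitely many predicates of the tail, all controlled by `B₀`; for larger
    -- heads `B∞` controls the tail. With `X ≤ B`, agreeing heads lie on the same side of `X`.
    B = B₀ ⊔ (X ⊔ B∞)

    X≤B : X ≤ B
    X≤B = ℕₚ.≤-trans (ℕₚ.m≤m⊔n X B∞) (ℕₚ.m≤n⊔m B₀ _)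

    -- Pointwise equal functions need not be equal, so `P` is transported along a trivial instance
    -- of `⊑`.
    cons-η : ∀ {x v} → x ≡ v zero → P (x F.∷ F.tail v) → P v
    cons-η eq = P-mono λ { zero → inj₁ eq ; (suc i) → inj₁ refl }

    closed-small : ∀ {u v} → AgreeBelow B u v → u zero < X → P u → P v
    closed-small {u} {v} u≈v u₀<X Pu with u≈v zero
    ... | inj₂ (B≤u₀ , _) = contradiction u₀<X (ℕₚ.≤⇒≯ (ℕₚ.≤-trans X≤B B≤u₀))
    ... | inj₁ u₀≡v₀ = cons-η u₀≡v₀
      (proj₂ tails (u zero) (∈ₚ.∈-upTo⁺ u₀<X) (agree-weaken (ℕₚ.m≤m⊔n B₀ _) (u≈v ∘ suc))
        (P-mono (λ { zero → inj₁ refl ; (suc i) → inj₁ refl }) Pu))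

    closed-large : ∀ {u v} → AgreeBelow B u v → X ≤ u zero → P u → P v
    closed-large {u} {v} u≈v X≤u₀ Pu =
      P-mono (λ { zero → inj₂ (2≤X , X≤v₀) ; (suc i) → inj₁ refl })
        (at-X (F.tail v)
          (proj₂ tails∞
            (agree-weaken (ℕₚ.≤-trans (ℕₚ.m≤n⊔m X B∞) (ℕₚ.m≤n⊔m B₀ _)) (u≈v ∘ suc))
            (u zero , ℕₚ.≤-trans 2≤X X≤u₀ ,
             P-mono (λ { zero → inj₁ refl ; (suc i) → inj₁ refl }) Pu)))
      where
      X≤v₀ : X ≤ v zero
      X≤v₀ with u≈v zero
      ... | inj₁ u₀≡v₀      = subst (X ≤_) u₀≡v₀ X≤u₀
      ... | inj₂ (_ , B≤v₀) = ℕₚ.≤-trans X≤B B≤v₀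

    closed : ∀ {u v} → AgreeBelow B u v → P u → P v
    closed {u} u≈v with u zero ℕₚ.<? X
    ... | yes u₀<X = closed-small u≈v u₀<X
    ... | no  u₀≮X = closed-large u≈v (ℕₚ.≮⇒≥ u₀≮X)

  module _ {ℓ : Level} where

    select : {A : Set} → (A → Set ℓ) → List A → List A
    select P = filter (λ x → em {P = P x})

    card : {A : Set} → (A → Set ℓ) → List A → ℕ
    card P xs = length (select P xs)

    card-cong : ∀ {A : Set} {P Q : A → Set ℓ} → (∀ x → P x ⇔ Q x) → ∀ xs → card P xs ≡ card Q xs
    card-cong P⇔Q xs = cong length (Listₚ.filter-≐ _ _
      ((λ {x} → Equivalence.to (P⇔Q x)) , (λ {x} → Equivalence.from (P⇔Q x))) xs)

    card-none : ∀ {A : Set} {P : A → Set ℓ} → (∀ x → ¬ P x) → ∀ xs → card P xs ≡ 0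
    card-none ¬P xs = cong length (Listₚ.filter-none _ (All.universal ¬P xs))

    card-++ : ∀ {A : Set} (P : A → Set ℓ) xs ys → card P (xs ++ ys) ≡ card P xs + card P ys
    card-++ P xs ys = trans (cong length (Listₚ.filter-++ _ xs ys)) (Listₚ.length-++ (select P xs))

    card-map : ∀ {A B : Set} (P : B → Set ℓ) (f : A → B) xs → card P (List.map f xs) ≡ card (P ∘ f) xs
    card-map P f []       = refl
    card-map P f (x ∷ xs) with em {P = P (f x)}
    ... | yes _ = cong suc (card-map P f xs)
    ... | no  _ = card-map P f xs

    card-cartesianProductWith : ∀ {A B C : Set} (P : C → Set ℓ) (f : A → B → C) xs ys →
      card P (cartesianProductWith f xs ys) ≡ listSum (List.map (λ x → card (P ∘ f x) ys) xs)
    card-cartesianProductWith P f []       ys = refl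
    card-cartesianProductWith P f (x ∷ xs) ys =
      trans (card-++ P (List.map (f x) ys) _)
        (cong₂ _+_ (card-map P (f x) ys) (card-cartesianProductWith P f xs ys))

    -- Reading a letter that already occurs at least B times does not change which
    -- continuations are accepted, so the counts satisfy a triangular linear recurrence.
    module _ {k : ℕ} (B : ℕ) (1≤B : 1 ≤ B) (Q : (Fin k → ℕ) → Set ℓ)
             (Q-resp : ∀ {u v} → AgreeBelow B u v → Q u → Q v) where

      Accepted : (Fin k → ℕ) → ∀ {n} → Vec (Fin k) n → Set ℓ
      Accepted s w = RestrictedGrowth s w × Q (λ j → count w j + s j)

      step-agree : ∀ (i : Fin k) {s t} → AgreeBelow B s t → AgreeBelow B (step i s) (step i t)
      step-agree i s≈t j with s≈t j
      ... | inj₁ s≡t         = inj₁ (cong (δ i j +_) s≡t)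
      ... | inj₂ (B≤s , B≤t) =
        inj₂ (ℕₚ.≤-trans B≤s (ℕₚ.m≤n+m _ (δ i j)) , ℕₚ.≤-trans B≤t (ℕₚ.m≤n+m _ (δ i j)))

      -- Growth sees only whether a letter has occurred, and truncation at `B ≥ 1` preserves that.
      growth-agree : ∀ {s t n} (w : Vec (Fin k) n) → AgreeBelow B s t →
        RestrictedGrowth s w → RestrictedGrowth t w
      growth-agree []      s≈t _           = tt
      growth-agree (i ∷ w) s≈t (i-ok , rg) =
        (λ j j<i → [ (λ s≡t → subst (1 ≤_) s≡t (i-ok j j<i)) , (λ (_ , B≤t) → ℕₚ.≤-trans 1≤B B≤t) ]′ (s≈t j)) ,
        growth-agree w (step-agree i s≈t) rg

      accepted-agree : ∀ {s t n} (w : Vec (Fin k) n) → AgreeBelow B s t → Accepted s w → Accepted t w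
      accepted-agree w s≈t (rg , q) = growth-agree w s≈t rg ,
        Q-resp (λ j → [ (λ s≡t → inj₁ (cong (count w j +_) s≡t)) ,
                        (λ (B≤s , B≤t) → inj₂ (ℕₚ.≤-trans B≤s (ℕₚ.m≤n+m _ (count w j)) ,
                                               ℕₚ.≤-trans B≤t (ℕₚ.m≤n+m _ (count w j)))) ]′ (s≈t j)) q

      accepted-∷ : ∀ {s i n} (w : Vec (Fin k) n) → Allowed s i → Accepted s (i ∷ w) ⇔ Accepted (step i s) w
      accepted-∷ {s} {i} w i-ok = mk⇔
        (λ ((_ , rg) , q) → rg , Q-resp (λ j → inj₁ (shift j)) q)
        (λ (rg , q) → (i-ok , rg) , Q-resp (λ j → inj₁ (sym (shift j))) q)
        where
        open +-*-Solver
        shift : ∀ j → (δ i j + count w j) + s j ≡ count w j + (δ i j + s j)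
        shift j = solve 3 (λ d c s → (d :+ c) :+ s := c :+ (d :+ s)) refl (δ i j) (count w j) (s j)

      slack : (Fin k → ℕ) → ℕ
      slack s = total λ i → B ∸ s i

      slack-step : ∀ (i : Fin k) s → s i < B → slack (step i s) < slack s
      slack-step i s si<B = total-mono-<
        (λ j → ℕₚ.∸-monoʳ-≤ B (ℕₚ.m≤n+m (s j) (δ i j))) i
        (ℕₚ.∸-monoʳ-< (subst (λ d → s i < d + s i) (sym (δ-refl i)) ℕₚ.≤-refl) (subst (λ d → d + s i ≤ B) (sym (δ-refl i)) si<B))

      saturated-step : ∀ (i : Fin k) s → B ≤ s i → AgreeBelow B s (step i s)
      saturated-step i s B≤si j with i Finₚ.≟ j
      ... | yes refl = inj₂ (B≤si , ℕₚ.m≤n⇒m≤1+n B≤si)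
      ... | no  _    = inj₁ refl

      words : ∀ n → List (Vec (Fin k) n)
      words = allVecs (allFin k)

      -- The argument `m` bounds `slack s` and is the recursion measure. Each saturated allowed
      -- letter gives back the same sequence, at most `k` times in all; an unsaturated one leads to
      -- a state of smaller slack, and a disallowed one contributes zero.
      accepted-expPoly : ∀ m s → slack s < m → EventuallyExpPoly k (λ n → card (Accepted s) (words n))
      accepted-expPoly (suc m) s (s≤s slack≤m) =
        let d , d≤ , g , g-exp , eq = expPoly-letters after (allFin k) cases
        in expPoly-recurrence d (subst (d ≤_) (Listₚ.length-tabulate _) d≤) g-exp λ n →
             trans (card-cartesianProductWith (Accepted s) _∷_ (allFin k) (words n)) (eq n)
        where
        after : Fin k → ℕ → ℕ
        after i n = card (λ w → Accepted s (i ∷ w)) (words n)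
        cases : ∀ i → (∀ n → after i n ≡ card (Accepted s) (words n)) ⊎ EventuallyExpPoly k (after i)
        cases i with em {P = Allowed s i} | B ℕₚ.≤? s i
        ... | no ¬ok | _        =
          inj₂ (expPoly-cong (λ n → sym (card-none (λ w ((ok , _) , _) → ¬ok ok) (words n))) expPoly-0)
        ... | yes ok | yes B≤si = inj₁ λ n → card-cong
          (λ w → mk⇔
            (accepted-agree w (agree-sym (saturated-step i s B≤si)) ∘ Equivalence.to (accepted-∷ w ok))
            (Equivalence.from (accepted-∷ w ok) ∘ accepted-agree w (saturated-step i s B≤si)))
          (words n)
        ... | yes ok | no B≰si  =
          inj₂ (expPoly-cong (λ n → sym (card-cong (λ w → accepted-∷ w ok) (words n)))
            (accepted-expPoly m (step i s)
              (ℕₚ.<-≤-trans (slack-step i s (ℕₚ.≰⇒> B≰si)) slack≤m)))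

-- Cardinalities through lists of representatives.

lookup-ext : ∀ {A : Set} {n} {xs ys : Vec A n} → (∀ i → lookup xs i ≡ lookup ys i) → xs ≡ ys
lookup-ext {xs = xs} {ys} eq =
  trans (sym (Vecₚ.tabulate∘lookup xs)) (trans (Vecₚ.tabulate-cong eq) (Vecₚ.tabulate∘lookup ys))

true⇔true⇒≡ : ∀ {x y : Bool} → (x ≡ true → y ≡ true) → (y ≡ true → x ≡ true) → x ≡ y
true⇔true⇒≡ {true}  {y}     to from = sym (to refl)
true⇔true⇒≡ {false} {true}  to from = from refl
true⇔true⇒≡ {false} {false} to from = refl

does≡true⇒ : ∀ {ℓ} {P : Set ℓ} (P? : Dec P) → does P? ≡ true → P
does≡true⇒ (yes p) _ = p

lookup-injective : ∀ {A : Set} {xs : List A} → Unique xs → Injective _≡_ _≡_ (List.lookup xs)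
lookup-injective (x∉xs ∷ xs!) {zero}  {zero}  eq = refl
lookup-injective (x∉xs ∷ xs!) {zero}  {suc j} eq = contradiction eq (All.lookup x∉xs (∈ₚ.∈-lookup j))
lookup-injective (x∉xs ∷ xs!) {suc i} {zero}  eq = contradiction (sym eq) (All.lookup x∉xs (∈ₚ.∈-lookup i))
lookup-injective (x∉xs ∷ xs!) {suc i} {suc j} eq = cong suc (lookup-injective xs! eq)

module _ {a ℓ r : Level} (S : Setoid a ℓ) {A : Set} where
  open Setoid S using () renaming (Carrier to C; _≈_ to _≈ˢ_; refl to ≈ˢ-refl)

  -- A description determines an element only up to `≈ˢ`, so a relation that is single-valued and
  -- injective up to `≈ˢ` takes the place of a function with an inverse.
  hasCardinality-length : (Represents : A → C → Set r) (xs : List A) → Unique xs →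
    (∀ x → x ∈ xs → ∃ (Represents x)) →
    (∀ s → ∃ λ x → x ∈ xs × Represents x s) →
    (∀ {x s t} → Represents x s → Represents x t → s ≈ˢ t) →
    (∀ {x y s t} → Represents x s → Represents y t → s ≈ˢ t → x ≡ y) →
    HasCardinality S (length xs)
  hasCardinality-length Represents xs xs! represented onto functional injective = record
    { to        = to
    ; cong      = λ { refl → ≈ˢ-refl }
    ; bijective = (λ eq → lookup-injective xs! (injective (represents _) (represents _) eq)) , λ s →
        let x , x∈xs , x-rep = onto s
        in index x∈xs , λ { refl → functional
             (subst (λ y → Represents y (to (index x∈xs))) (sym (Anyₚ.lookup-index x∈xs)) (represents _)) x-rep }
    }
    where
    to : Fin (length xs) → C
    to i = proj₁ (represented (List.lookup xs i) (∈ₚ.∈-lookup i))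
    represents : ∀ i → Represents (List.lookup xs i) (to i)
    represents i = proj₂ (represented (List.lookup xs i) (∈ₚ.∈-lookup i))

-- Transpositions, colourings and keys of tuples.

transpose-natural : ∀ {m n} {g : Fin m → Fin n} → Injective _≡_ _≡_ g → ∀ a b x →
  transpose (g a) (g b) (g x) ≡ g (transpose a b x)
transpose-natural {g = g} g-inj a b x with x Finₚ.≟ a
... | yes refl = transpose-left (g a) (g b)
... | no x≢a with x Finₚ.≟ b
...   | yes refl = transpose-right (g a) (g b)
...   | no x≢b   = transpose-other (g a) (g b) (x≢a ∘ g-inj) (x≢b ∘ g-inj)

transpose-colour : ∀ {k n} (w : Vec (Fin k) n) {a b} → lookup w a ≡ lookup w b → ∀ x →
  lookup w (transpose a b x) ≡ lookup w x
transpose-colour w {a} {b} eq x with x Finₚ.≟ a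
... | yes refl = sym eq
... | no _ with x Finₚ.≟ b
...   | yes refl = eq
...   | no _     = refl

-- The colours and the equality matrix of an `m`-tuple. The size of the underlying set does not
-- enter, so one truth table serves words of every length.
Key : ℕ → ℕ → Set
Key k m = Vec (Fin k × Vec Bool m) m

key : ∀ {k m n} → Vec (Fin k) n → Vec (Fin n) m → Key k m
key w xs = Vec.map (λ x → lookup w x , Vec.map (λ y → does (x Finₚ.≟ y)) xs) xs

key-map : ∀ {k l m n} (u : Vec (Fin k) m) (w : Vec (Fin k) n) {g : Fin m → Fin n} →
  Injective _≡_ _≡_ g → (∀ a → lookup w (g a) ≡ lookup u a) →
  (xs : Vec (Fin m) l) → key w (Vec.map g xs) ≡ key u xs
key-map u w {g} g-inj g-col xs = trans (sym (Vecₚ.map-∘ _ g xs)) (Vecₚ.map-cong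
  (λ x → cong₂ _,_ (g-col x) (trans (sym (Vecₚ.map-∘ _ g xs)) (Vecₚ.map-cong
    (λ y → does-⇔ (mk⇔ g-inj (cong g)) (g x Finₚ.≟ g y) (x Finₚ.≟ y)) xs))) xs)

module _ {k n : ℕ} (w : Vec (Fin k) n) where

  key-colour : ∀ {m} {xs ys : Vec (Fin n) m} → key w xs ≡ key w ys →
    ∀ i → lookup w (lookup xs i) ≡ lookup w (lookup ys i)
  key-colour {xs = xs} {ys} eq i =
    trans (sym (cong proj₁ (Vecₚ.lookup-map i _ xs)))
      (trans (cong (λ κ → proj₁ (lookup κ i)) eq) (cong proj₁ (Vecₚ.lookup-map i _ ys)))

  key-equality : ∀ {m} {xs ys : Vec (Fin n) m} → key w xs ≡ key w ys →
    ∀ i j → lookup xs i ≡ lookup xs j → lookup ys i ≡ lookup ys j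
  key-equality {xs = xs} {ys} eq i j xᵢ≡xⱼ = does≡true⇒ (lookup ys i Finₚ.≟ lookup ys j)
    (trans (sym (entry ys)) (trans (cong (λ κ → lookup (proj₂ (lookup κ i)) j) (sym eq))
      (trans (entry xs) (dec-true (lookup xs i Finₚ.≟ lookup xs j) xᵢ≡xⱼ))))
    where
    entry : ∀ zs → lookup (proj₂ (lookup (key w zs) i)) j ≡ does (lookup zs i Finₚ.≟ lookup zs j)
    entry zs = trans (cong (λ e → lookup (proj₂ e) j) (Vecₚ.lookup-map i _ zs)) (Vecₚ.lookup-map j _ zs)

-- Interchangeable elements, restrictions and templates.

module _ (L : Language) where
  open Language L
  open Interpretation

  module _ {n : ℕ} (I : Interpretation L (Fin n)) where

    -- One implication suffices, the transposition being an involution.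
    Swappable : Fin n → Fin n → Set
    Swappable a b = (∀ R xs → rel I R xs → rel I R (Vec.map (transpose a b) xs)) ×
                    (∀ c → transpose a b (const I c) ≡ const I c)

    swappable⇒interchangeable : ∀ {a b} → Swappable a b → Interchangeable (structure (Fin n) I) a b
    swappable⇒interchangeable {a} {b} (rel-τ , const-τ) =
      record
        { bijection = mk↔ₛ′ τ τ (transpose-involutive a b) (transpose-involutive a b)
        ; rel-⇔     = λ R xs → mk⇔ (rel-τ R xs) λ r →
            subst (rel I R) (trans (sym (Vecₚ.map-∘ τ τ xs))
              (trans (Vecₚ.map-cong (transpose-involutive a b) xs) (Vecₚ.map-id xs))) (rel-τ R _ r)
        ; const-≡   = const-τ
        } ,
      transpose-left a b , transpose-right a b , λ _ → transpose-other a b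
      where τ = transpose a b

    interchangeable⇒swappable : ∀ {a b} → Interchangeable (structure (Fin n) I) a b → Swappable a b
    interchangeable⇒swappable {a} {b} (σ , σa≡b , σb≡a , σ-fix) =
      (λ R xs r → subst (rel I R) (Vecₚ.map-cong σ≗τ xs) (Equivalence.to (σ.rel-⇔ R xs) r)) ,
      λ c → trans (sym (σ≗τ (const I c))) (σ.const-≡ c)
      where
      module σ = _≅_ σ
      σ≗τ : ∀ x → σ.to x ≡ transpose a b x
      σ≗τ x with x Finₚ.≟ a
      ... | yes refl = σa≡b
      ... | no x≢a with x Finₚ.≟ b
      ...   | yes refl = σb≡a
      ...   | no x≢b   = σ-fix x x≢a x≢b

  swappable-resp-≈ : ∀ {n} {I J : Interpretation L (Fin n)} → I ≈ J → ∀ {a b} →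
    Swappable I a b → Swappable J a b
  swappable-resp-≈ {I = I} {J} (rel-≐ , const-≗) {a} {b} (rel-τ , const-τ) =
    (λ R xs → proj₁ (rel-≐ R) ∘ rel-τ R xs ∘ proj₂ (rel-≐ R)) ,
    λ c → subst (λ x → transpose a b x ≡ x) (const-≗ c) (const-τ c)

  -- Changing the entries of xs into those of ys one at a time by transpositions shows
  -- that the truth of a relation depends only on the key.
  module _ {k n : ℕ} (I : Interpretation L (Fin n)) (w : Vec (Fin k) n)
           (homogeneous : ∀ a b → lookup w a ≡ lookup w b → Swappable I a b) where

    rel-key : ∀ R {xs ys} → key w xs ≡ key w ys → rel I R xs → rel I R ys
    rel-key R {xs} {ys} eq = go (arity R) 0 (ℕₚ.+-identityʳ _) xs
      (key-colour w eq) (key-equality w eq) (key-equality w (sym eq)) λ _ ()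
      where
      go : ∀ f t → f + t ≡ arity R → ∀ xs →
        (∀ i → lookup w (lookup xs i) ≡ lookup w (lookup ys i)) →
        (∀ i j → lookup xs i ≡ lookup xs j → lookup ys i ≡ lookup ys j) →
        (∀ i j → lookup ys i ≡ lookup ys j → lookup xs i ≡ lookup xs j) →
        (∀ i → toℕ i < t → lookup xs i ≡ lookup ys i) → rel I R xs → rel I R ys
      go zero    t refl  xs col x⇒y y⇒x agree =
        subst (rel I R) (lookup-ext λ i → agree i (Finₚ.toℕ<n i))
      go (suc f) t f+t≡m xs col x⇒y y⇒x agree =
        go f (suc t) (trans (ℕₚ.+-suc f t) f+t≡m) (Vec.map τ xs)
          (λ j → trans (cong (lookup w) (Vecₚ.lookup-map j τ xs))
                   (trans (transpose-colour w (col i) (lookup xs j)) (col j)))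
          (λ j j′ e → x⇒y j j′ (transpose-injective (lookup xs i) (lookup ys i)
            (trans (sym (Vecₚ.lookup-map j τ xs)) (trans e (Vecₚ.lookup-map j′ τ xs)))))
          (λ j j′ e → trans (Vecₚ.lookup-map j τ xs)
            (trans (cong τ (y⇒x j j′ e)) (sym (Vecₚ.lookup-map j′ τ xs))))
          (λ j j<1+t → trans (Vecₚ.lookup-map j τ xs) (moved j j<1+t))
        ∘ proj₁ (homogeneous (lookup xs i) (lookup ys i) (col i)) R xs
        where
        t<m : t < arity R
        t<m = subst (suc t ≤_) f+t≡m (s≤s (ℕₚ.m≤n+m t f))
        i : Fin (arity R)
        i = fromℕ< t<m
        τ : Fin n → Fin n
        τ = transpose (lookup xs i) (lookup ys i)
        -- An entry equal to `lookup xs i` goes to `lookup ys i`, which is its own target by the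
        -- equality pattern. Any other entry before `t` already equals its target, and the converse
        -- pattern keeps it different from `lookup ys i`, so `τ` fixes it.
        moved : ∀ j → toℕ j < suc t → τ (lookup xs j) ≡ lookup ys j
        moved j j<1+t with lookup xs j Finₚ.≟ lookup xs i
        ... | yes xⱼ≡xᵢ = sym (x⇒y j i xⱼ≡xᵢ)
        ... | no  xⱼ≢xᵢ with ℕₚ.m≤n⇒m<n∨m≡n (ℕₚ.≤-pred j<1+t)
        ...   | inj₂ j≡t = contradiction
                  (cong (lookup xs) (Finₚ.toℕ-injective (trans j≡t (sym (Finₚ.toℕ-fromℕ< t<m))))) xⱼ≢xᵢ
        ...   | inj₁ j<t with lookup xs j Finₚ.≟ lookup ys i
        ...     | yes xⱼ≡yᵢ = contradiction (y⇒x j i (trans (sym (agree j j<t)) xⱼ≡yᵢ)) xⱼ≢xᵢ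
        ...     | no  _     = agree j j<t

  module _ {m n : ℕ} (I : Interpretation L (Fin n)) (g : Fin m → Fin n)
           (g-injective : Injective _≡_ _≡_ g)
           (κ : Fin #constants → Fin m) (g∘κ : ∀ c → g (κ c) ≡ const I c) where

    pullback : Interpretation L (Fin m)
    pullback = record { rel = λ R xs → rel I R (Vec.map g xs) ; const = κ }

    swappable-pullback : ∀ {a b} → Swappable I (g a) (g b) → Swappable pullback a b
    swappable-pullback {a} {b} (rel-τ , const-τ) =
      (λ R xs r → subst (rel I R)
        (trans (sym (Vecₚ.map-∘ _ g xs))
          (trans (Vecₚ.map-cong (transpose-natural g-injective a b) xs) (Vecₚ.map-∘ g _ xs)))
        (rel-τ R _ r)) ,
      λ c → g-injective (trans (sym (transpose-natural g-injective a b (κ c)))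
        (trans (cong (transpose (g a) (g b)) (g∘κ c)) (trans (const-τ c) (sym (g∘κ c)))))

    pullback-closed : ∀ {ℓ} {H : Pred (Structure L) ℓ} → Hereditary H →
      H (structure (Fin n) I) → H (structure (Fin m) pullback)
    pullback-closed hereditary h = Hereditary.≅-closed hereditary image≅pullback
      (Hereditary.substructure-closed hereditary _ _ (λ c → κ c , g∘κ c) h)
      where
      Image : Pred (Fin n) 0ℓ
      Image x = ∃ λ a → g a ≡ x
      -- The proof of membership is irrelevant, so a preimage is recovered by a decidable search
      -- over `Fin m`.
      preimage : (y : Refinement (Fin n) Image) → Image (value y)
      preimage (x , [ p ]) = recompute (Finₚ.any? λ a → g a Finₚ.≟ x) p
      image≅pullback : substructure (structure (Fin n) I) Image (λ c → κ c , g∘κ c) ≅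
                       structure (Fin m) pullback
      image≅pullback = record
        { bijection = mk↔ₛ′ (proj₁ ∘ preimage) (λ a → g a , [ (a , refl) ])
            (λ a → g-injective (proj₂ (preimage (g a , [ (a , refl) ]))))
            (λ y → value-injective (proj₂ (preimage y)))
        ; rel-⇔   = λ R ys →
            let eq = trans (Vecₚ.map-cong (λ y → sym (proj₂ (preimage y))) ys) (Vecₚ.map-∘ g _ ys)
            in mk⇔ (subst (rel I R) eq) (subst (rel I R) (sym eq))
        ; const-≡ = λ c → g-injective
            (trans (proj₂ (preimage (const I c , [ (κ c , g∘κ c) ]))) (sym (g∘κ c)))
        }

  module _ (k : ℕ) where

    SymbolKey : Set
    SymbolKey = Σ (Fin #relations) λ R → Key k (arity R)

    bools : List Bool
    bools = true ∷ false ∷ []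

    ∈-bools : ∀ b → b ∈ bools
    ∈-bools true  = here refl
    ∈-bools false = there (here refl)

    symbolKeys : List SymbolKey
    symbolKeys = concatMap
      (λ R → List.map (R ,_)
        (allVecs (cartesianProduct (allFin k) (allVecs bools (arity R))) (arity R)))
      (allFin #relations)

    ∈-symbolKeys : ∀ κ → κ ∈ symbolKeys
    ∈-symbolKeys (R , κ) = ∈ₚ.∈-concatMap⁺ _ (lose (∈ₚ.∈-allFin R) (∈ₚ.∈-map⁺ (R ,_)
      (∈-allVecs (λ (i , bs) → ∈ₚ.∈-cartesianProduct⁺ (∈ₚ.∈-allFin i) (∈-allVecs ∈-bools bs)) κ)))

    code : SymbolKey → Fin (length symbolKeys)
    code κ = index (∈-symbolKeys κ)

    code-injective : Injective _≡_ _≡_ code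
    code-injective {κ} {κ′} eq = trans (Anyₚ.lookup-index (∈-symbolKeys κ))
      (trans (cong (List.lookup symbolKeys) eq) (sym (Anyₚ.lookup-index (∈-symbolKeys κ′))))

    -- Vectors rather than functions, so that pointwise equal tables are propositionally equal and
    -- can be listed without repetition.
    Template : Set
    Template = Vec Bool (length symbolKeys) × Vec (Fin k) #constants

    templates : List Template
    templates = cartesianProduct (allVecs bools _) (allVecs (allFin k) _)

    ∈-templates : ∀ T → T ∈ templates
    ∈-templates (bs , is) = ∈ₚ.∈-cartesianProduct⁺ (∈-allVecs ∈-bools bs) (∈-allVecs ∈ₚ.∈-allFin is)

    templates-unique : Unique templates
    templates-unique = Uniqueₚ.cartesianProduct⁺
      (allVecs-unique (((λ ()) ∷ []) ∷ [] ∷ []) _)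
      (allVecs-unique (Uniqueₚ.allFin⁺ k) _)

    -- Exchanging a constant with another element moves the constant, so its class is a singleton.
    -- `const-unique` records this, and makes the colour determine the constant.
    record Realizes (T : Template) {n} (w : Vec (Fin k) n) (I : Interpretation L (Fin n)) : Set where
      field
        rel-code     : ∀ R xs → rel I R xs ⇔ lookup (proj₁ T) (code (R , key w xs)) ≡ true
        const-colour : ∀ c → lookup w (const I c) ≡ lookup (proj₂ T) c
        const-unique : ∀ c a → lookup w a ≡ lookup (proj₂ T) c → a ≡ const I c

    -- Makes the template of a structure unique: keys not occurring in w have value false.
    Full : Template → ∀ {n} → Vec (Fin k) n → Set
    Full T w = ∀ t → lookup (proj₁ T) t ≡ true → ∃ λ R → ∃ λ xs → code (R , key w xs) ≡ t

    -- Combined with `realizes⇒homogeneous`, this makes the colour classes exactly the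
    -- interchangeability classes.
    Separated : ∀ {n} → Vec (Fin k) n → Interpretation L (Fin n) → Set
    Separated w I = ∀ a b → Swappable I a b → lookup w a ≡ lookup w b

    rel-code-invariant : ∀ {n} (I : Interpretation L (Fin n)) (w : Vec (Fin k) n) →
      (∀ a b → lookup w a ≡ lookup w b → Swappable I a b) → ∀ {R S xs ys} →
      code (R , key w xs) ≡ code (S , key w ys) → rel I R xs → rel I S ys
    rel-code-invariant I w homogeneous eq = go (code-injective eq) refl refl
      where
      -- The equation of dependent pairs can be matched only when both keys are variables, whence
      -- the two extra equations.
      go : ∀ {R S κ κ′ xs ys} → _≡_ {A = SymbolKey} (R , κ) (S , κ′) → key w xs ≡ κ → key w ys ≡ κ′ →
        rel I R xs → rel I S ys
      go {R} refl eq eq′ = rel-key I w homogeneous R (trans eq (sym eq′))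

    module _ {T : Template} {n : ℕ} {w : Vec (Fin k) n} {I : Interpretation L (Fin n)}
             (I-T : Realizes T w I) where
      open Realizes I-T

      -- A transposition inside a colour class is a colour-preserving injection and so leaves every
      -- key unchanged. It sends a constant to an element of the same colour, hence to the constant
      -- itself.
      realizes⇒homogeneous : ∀ a b → lookup w a ≡ lookup w b → Swappable I a b
      realizes⇒homogeneous a b eq =
        (λ R xs r → Equivalence.from (rel-code R (Vec.map (transpose a b) xs))
          (trans (cong (λ κ → lookup (proj₁ T) (code (R , κ)))
                   (key-map w w (transpose-injective a b) (transpose-colour w eq) xs))
                 (Equivalence.to (rel-code R xs) r))) ,
        λ c → const-unique c _ (trans (transpose-colour w eq (const I c)) (const-colour c))

      realizes-unique : ∀ {J} → Realizes T w J → I ≈ J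
      realizes-unique J-T =
        (λ R → (λ {xs} → Equivalence.from (J.rel-code R xs) ∘ Equivalence.to (rel-code R xs)) ,
               (λ {xs} → Equivalence.from (rel-code R xs) ∘ Equivalence.to (J.rel-code R xs))) ,
        λ c → sym (const-unique c _ (J.const-colour c))
        where module J = Realizes J-T

    module _ (T : Template) {m n : ℕ} (u : Vec (Fin k) m) (w : Vec (Fin k) n)
             (u⊑w : count u ⊑ count w) where

      private
        emb = embedding u w (⊑⇒≤ u⊑w)
        g = proj₁ emb
        g-injective = proj₁ (proj₂ emb)
        g-colour = proj₂ (proj₂ emb)

        occurs : ∀ b → ∃ λ a → lookup u a ≡ lookup w b
        occurs b = count⇒lookup u _ (⊑-reflects-occurrence u⊑w _ (count-lookup w b))

      full-extends : Full T u → Full T w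
      full-extends u-full t t-true =
        let R , xs , eq = u-full t t-true
        in R , Vec.map g xs , trans (cong (λ κ → code (R , κ)) (key-map u w g-injective g-colour xs)) eq

      module _ (J : Interpretation L (Fin n)) (J-T : Realizes T w J) where
        open Realizes J-T

        private
          κ : Fin #constants → Fin m
          κ c = proj₁ (occurs (const J c))

          κ-colour : ∀ c → lookup u (κ c) ≡ lookup (proj₂ T) c
          κ-colour c = trans (proj₂ (occurs (const J c))) (const-colour c)

          -- `κ c` was chosen by its colour alone; its image is the constant because no other
          -- element has that colour.
          g∘κ : ∀ c → g (κ c) ≡ const J c
          g∘κ c = const-unique c _ (trans (g-colour (κ c)) (κ-colour c))

        restriction : Interpretation L (Fin m)
        restriction = pullback J g g-injective κ g∘κ

        restriction-closed : ∀ {ℓ} {H : Pred (Structure L) ℓ} → Hereditary H →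
          H (structure (Fin n) J) → H (structure (Fin m) restriction)
        restriction-closed = pullback-closed J g g-injective κ g∘κ

        restriction-realizes : Realizes T u restriction
        restriction-realizes = record
          { rel-code     = λ R xs →
              subst (λ κ → rel J R (Vec.map g xs) ⇔ lookup (proj₁ T) (code (R , κ)) ≡ true)
                (key-map u w g-injective g-colour xs) (rel-code R (Vec.map g xs))
          ; const-colour = κ-colour
          ; const-unique = λ c a eq → g-injective
              (trans (const-unique c (g a) (trans (g-colour a) eq)) (sym (g∘κ c)))
          }

        -- The elements `a` and `b` may lie outside the image of `g`. Homogeneity replaces them by
        -- interchangeable elements of the image with the same colours, to which separation over `u`
        -- applies.
        separated-extends : (∀ {a b c} → Swappable J a b → Swappable J b c → Swappable J a c) →
          Separated u restriction → Separated w J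
        separated-extends swap-trans u-sep a b ab =
          let a′ , a′≡a = occurs a
              b′ , b′≡b = occurs b
              homogeneous = realizes⇒homogeneous J-T
              a~ = homogeneous (g a′) a (trans (g-colour a′) a′≡a)
              ~b = homogeneous b (g b′) (sym (trans (g-colour b′) b′≡b))
          in trans (sym a′≡a) (trans
               (u-sep a′ b′ (swappable-pullback J g g-injective κ g∘κ (swap-trans a~ (swap-trans ab ~b))))
               b′≡b)

-- Counting the members of a basic hereditary property.

module Counting (em : ∀ {ℓ} → ExcludedMiddle ℓ) (L : Language) {ℓ : Level} (H : Pred (Structure L) ℓ)
                (hereditary : Hereditary H) (k : ℕ)
                (classes : ∀ M → H M → AtMostClasses k M) where
  open Language L
  open Interpretation
  open Classical em

  module _ {n : ℕ} {I : Interpretation L (Fin n)} (h : H (structure (Fin n) I)) where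

    class : Fin n → Fin k
    class = proj₁ (classes (structure (Fin n) I) h)

    swappable⇒class≡ : ∀ {a b} → Swappable L I a b → class a ≡ class b
    swappable⇒class≡ ab = proj₁ (proj₂ (classes _ h)) (swappable⇒interchangeable L I ab)

    class≡⇒swappable : ∀ {a b} → class a ≡ class b → Swappable L I a b
    class≡⇒swappable eq = interchangeable⇒swappable L I (proj₂ (proj₂ (classes _ h)) eq)

    -- Read off from equality of classes, with no conjugation of transpositions.
    swappable-trans : ∀ {a b c} → Swappable L I a b → Swappable L I b c → Swappable L I a c
    swappable-trans ab bc = class≡⇒swappable (trans (swappable⇒class≡ ab) (swappable⇒class≡ bc))

  -- The upward closure of `P` is a predicate of counts, `⊑`-closed by transitivity, so it has a
  -- bound. Monotonicity of `P` leads from the word found there to `w`.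
  ⊑-closed-words : ∀ {ℓ′} (P : ∀ {n} → Vec (Fin k) n → Set ℓ′) →
    (∀ {m n} (u : Vec (Fin k) m) (w : Vec (Fin k) n) → count u ⊑ count w → P u → P w) →
    ∃ λ B → ∀ {m n} (u : Vec (Fin k) m) (w : Vec (Fin k) n) → AgreeBelow B (count u) (count w) → P u → P w
  ⊑-closed-words P P-mono =
    let B , closed = ⊑-closed⇒agree-closed k
          (λ v → ∃ λ n → Σ (Vec (Fin k) n) λ w → count w ⊑ v × P w)
          (λ v⊑v′ (n , w , w⊑v , Pw) → n , w , ⊑-trans w⊑v v⊑v′ , Pw)
    in B , λ u w u≈w Pu →
         let _ , w′ , w′⊑w , Pw′ = closed u≈w (_ , u , (λ _ → inj₁ refl) , Pu)
         in P-mono w′ w w′⊑w Pw′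

  module _ (T : Template L k) where

    Realizable : ∀ {n} → Vec (Fin k) n → Set (lsuc 0ℓ ⊔ˡ ℓ)
    Realizable {n} w = ∃ λ I → H (structure (Fin n) I) × Realizes L k T w I

    -- A realization is unique up to `≈`, so on realizable words "every" and "some" agree. The
    -- universal form is the one that passes upwards, since realizations over the larger word
    -- restrict to the smaller.
    AlwaysSeparated : ∀ {n} → Vec (Fin k) n → Set (lsuc 0ℓ ⊔ˡ ℓ)
    AlwaysSeparated {n} w = ∀ I → H (structure (Fin n) I) → Realizes L k T w I → Separated L k w I

    Core : ∀ {n} → Vec (Fin k) n → Set (lsuc 0ℓ ⊔ˡ ℓ)
    Core w = Realizable w × AlwaysSeparated w × Full L k T w

    Valid : ∀ {n} → Vec (Fin k) n → Set (lsuc 0ℓ ⊔ˡ ℓ)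
    Valid w = RestrictedGrowth (λ _ → 0) w × Core w

    unrealizable-bound : ∃ λ B → ∀ {m n} (u : Vec (Fin k) m) (w : Vec (Fin k) n) →
      AgreeBelow B (count u) (count w) → ¬ Realizable u → ¬ Realizable w
    unrealizable-bound = ⊑-closed-words (λ w → ¬ Realizable w) λ u w u⊑w ¬u (J , hJ , J-T) →
      ¬u (restriction L k T u w u⊑w J J-T ,
          restriction-closed L k T u w u⊑w J J-T hereditary hJ ,
          restriction-realizes L k T u w u⊑w J J-T)

    separated-bound : ∃ λ B → ∀ {m n} (u : Vec (Fin k) m) (w : Vec (Fin k) n) →
      AgreeBelow B (count u) (count w) → AlwaysSeparated u → AlwaysSeparated w
    separated-bound = ⊑-closed-words AlwaysSeparated λ u w u⊑w u-sep J hJ J-T →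
      separated-extends L k T u w u⊑w J J-T (swappable-trans hJ)
        (u-sep _ (restriction-closed L k T u w u⊑w J J-T hereditary hJ)
                 (restriction-realizes L k T u w u⊑w J J-T))

    full-bound : ∃ λ B → ∀ {m n} (u : Vec (Fin k) m) (w : Vec (Fin k) n) →
      AgreeBelow B (count u) (count w) → Full L k T u → Full L k T w
    full-bound = ⊑-closed-words (Full L k T) λ u w u⊑w u-full → full-extends L k T u w u⊑w u-full

    core-bound : ∃ λ B → 1 ≤ B × (∀ {m n} (u : Vec (Fin k) m) (w : Vec (Fin k) n) →
      AgreeBelow B (count u) (count w) → Core u → Core w)
    core-bound =
      let B₁ , unrealizable = unrealizable-bound
          B₂ , separated    = separated-bound
          B₃ , full         = full-bound
          -- The successor secures `1 ≤ B`, needed for restricted growth.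
          B = suc (B₁ ⊔ (B₂ ⊔ B₃))
          B₁≤B = ℕₚ.m≤n⇒m≤1+n (ℕₚ.m≤m⊔n B₁ (B₂ ⊔ B₃))
          B₂≤B = ℕₚ.m≤n⇒m≤1+n (ℕₚ.≤-trans (ℕₚ.m≤m⊔n B₂ B₃) (ℕₚ.m≤n⊔m B₁ (B₂ ⊔ B₃)))
          B₃≤B = ℕₚ.m≤n⇒m≤1+n (ℕₚ.≤-trans (ℕₚ.m≤n⊔m B₂ B₃) (ℕₚ.m≤n⊔m B₁ (B₂ ⊔ B₃)))
      in B , s≤s z≤n , λ u w u≈w (u-real , u-sep , u-full) →
           -- The bound is for unrealizability, which is what passes upwards; symmetry of agreement
           -- and double negation turn it around.
           decidable-stable em (λ ¬w →
             unrealizable w u (agree-weaken B₁≤B (agree-sym u≈w)) ¬w u-real) ,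
           separated u w (agree-weaken B₂≤B u≈w) u-sep ,
           full u w (agree-weaken B₃≤B u≈w) u-full

    valid-expPoly : EventuallyExpPoly k (λ n → card Valid (allVecs (allFin k) n))
    valid-expPoly = expPoly-cong
      (λ n → card-cong (λ w → mk⇔
        (λ (rg , _ , w′ , w′≈w , c) →
          rg , core w′ w (λ j → subst (λ x → count w′ j ≡ x ⊎ (B ≤ count w′ j × B ≤ x))
                                  (ℕₚ.+-identityʳ _) (w′≈w j)) c)
        (λ (rg , c) → rg , _ , w , (λ j → inj₁ (sym (ℕₚ.+-identityʳ _))) , c))
        (allVecs (allFin k) n))
      (accepted-expPoly B 1≤B CoreCounts
        (λ u≈v (n , w , w≈u , c) → n , w , agree-trans w≈u u≈v , c)
        _ (λ _ → 0) ℕₚ.≤-refl)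
      where
      B = proj₁ core-bound
      1≤B = proj₁ (proj₂ core-bound)
      core = proj₂ (proj₂ core-bound)
      -- `Core` speaks of words, the recurrence of counts. Closing under agreement gives a predicate
      -- of counts, and `core-bound` shows that this admits no new words.
      CoreCounts : (Fin k → ℕ) → Set (lsuc 0ℓ ⊔ˡ ℓ)
      CoreCounts v = ∃ λ n → Σ (Vec (Fin k) n) λ w → AgreeBelow B (count w) v × Core w

  module _ (n : ℕ) where

    Represents : Template L k × Vec (Fin k) n → Setoid.Carrier (members H n) → Set
    Represents (T , w) (I , _) =
      RestrictedGrowth (λ _ → 0) w × Realizes L k T w I × Separated L k w I × Full L k T w

    descriptions : List (Template L k × Vec (Fin k) n)
    descriptions = select (λ (T , w) → Valid T w)
      (cartesianProduct (templates L k) (allVecs (allFin k) n))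

    descriptions-unique : Unique descriptions
    descriptions-unique = Uniqueₚ.filter⁺ _
      (Uniqueₚ.cartesianProduct⁺ (templates-unique L k) (allVecs-unique (Uniqueₚ.allFin⁺ k) n))

    represents-some : ∀ x → x ∈ descriptions → ∃ (Represents x)
    represents-some (T , w) x∈ =
      let _ , rg , (I , h , I-T) , sep , full = ∈ₚ.∈-filter⁻ _ {xs = cartesianProduct (templates L k) (allVecs (allFin k) n)} x∈
      in (I , h) , rg , I-T , sep I h I-T , full

    represented : ∀ s → ∃ λ x → x ∈ descriptions × Represents x s
    represented (I , h) = (T , w) ,
      ∈ₚ.∈-filter⁺ _ (∈ₚ.∈-cartesianProduct⁺ (∈-templates L k T) (∈-allVecs ∈ₚ.∈-allFin w))
        (rg , (I , h , I-T) , (λ J _ J-T a b ab → sep a b (swappable-resp-≈ L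
                 (realizes-unique L k J-T I-T) ab)) , full) ,
      rg , I-T , sep , full
      where
      relabelling = restrictedGrowth-exists n (λ _ → 0) (Vec.tabulate (class h)) λ _ ()
      π = proj₁ relabelling
      w : Vec (Fin k) n
      w = Vec.map π (Vec.tabulate (class h))
      rg : RestrictedGrowth (λ _ → 0) w
      rg = proj₂ (proj₂ (proj₂ relabelling))

      lookup-w : ∀ a → lookup w a ≡ π (class h a)
      lookup-w a = trans (Vecₚ.lookup-map a π (Vec.tabulate (class h))) (cong π (Vecₚ.lookup∘tabulate (class h) a))

      homogeneous : ∀ a b → lookup w a ≡ lookup w b → Swappable L I a b
      homogeneous a b eq = class≡⇒swappable h
        (proj₁ (proj₂ relabelling) (trans (sym (lookup-w a)) (trans eq (lookup-w b))))

      sep : Separated L k w I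
      sep a b ab = trans (lookup-w a) (trans (cong π (swappable⇒class≡ h ab)) (sym (lookup-w b)))

      -- Asking for an actual tuple with this code makes the table full by construction; which tuple
      -- is taken is immaterial by `rel-code-invariant`.
      Occurs : Fin (length (symbolKeys L k)) → Set
      Occurs t = ∃ λ R → ∃ λ xs → code L k (R , key w xs) ≡ t × rel I R xs

      T : Template L k
      T = Vec.tabulate (λ t → does (em {P = Occurs t})) , Vec.tabulate (λ c → lookup w (const I c))

      lookup-T : ∀ t → lookup (proj₁ T) t ≡ does (em {P = Occurs t})
      lookup-T = Vecₚ.lookup∘tabulate (λ t → does (em {P = Occurs t}))

      occurs : ∀ t → lookup (proj₁ T) t ≡ true → Occurs t
      occurs t eq = does≡true⇒ em (trans (sym (lookup-T t)) eq)

      I-T : Realizes L k T w I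
      I-T = record
        { rel-code     = λ R xs → mk⇔
            (λ r → trans (lookup-T _) (dec-true em (R , xs , refl , r)))
            (λ eq → let _ , _ , same , r = occurs _ eq in rel-code-invariant L k I w homogeneous same r)
        ; const-colour = λ c → sym (Vecₚ.lookup∘tabulate _ c)
        ; const-unique = λ c a eq →
            -- Exchanging `a` with the constant fixes the constant, so the two coincide.
            let swap = homogeneous a (const I c) (trans eq (Vecₚ.lookup∘tabulate _ c))
            in trans (sym (transpose-right a (const I c))) (proj₂ swap c)
        }

      full : Full L k T w
      full t eq = let R , xs , same , _ = occurs t eq in R , xs , same

    -- Both words colour by the interchangeability classes of the same structure, hence coincide by
    -- restricted growth. `Full` provides a tuple behind each true entry of either table, and the
    -- structure then makes the other table true there.
    represents-injective : ∀ {x y I J} → Represents x I → Represents y J → proj₁ I ≈ proj₁ J → x ≡ y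
    represents-injective {T , w} {T′ , w′} {I , _} {J , _}
      (rg , I-T , sep , full) (rg′ , J-T , sep′ , full′) I≈J@(rel-≐ , const-≗)
      with refl ← restrictedGrowth-unique (λ _ → 0) w w′ rg rg′ (λ _ ()) (λ a b → mk⇔
             (λ eq → sep′ a b (swappable-resp-≈ L I≈J (realizes⇒homogeneous L k I-T a b eq)))
             (λ eq → sep a b (swappable-resp-≈ L (IsEquivalence.sym ≈-isEquivalence I≈J) (realizes⇒homogeneous L k J-T a b eq))))
      = cong (_, w) (cong₂ _,_
          (lookup-ext λ t → true⇔true⇒≡
            (λ eq → let R , xs , same = full t eq in
              subst (λ t → lookup (proj₁ T′) t ≡ true) same
                (Equivalence.to (Realizes.rel-code J-T R xs) (proj₁ (rel-≐ R)
                  (Equivalence.from (Realizes.rel-code I-T R xs)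
                    (subst (λ t → lookup (proj₁ T) t ≡ true) (sym same) eq)))))
            (λ eq → let R , xs , same = full′ t eq in
              subst (λ t → lookup (proj₁ T) t ≡ true) same
                (Equivalence.to (Realizes.rel-code I-T R xs) (proj₂ (rel-≐ R)
                  (Equivalence.from (Realizes.rel-code J-T R xs)
                    (subst (λ t → lookup (proj₁ T′) t ≡ true) (sym same) eq))))))
          (lookup-ext λ c → trans (sym (Realizes.const-colour I-T c))
            (trans (cong (lookup w) (const-≗ c)) (Realizes.const-colour J-T c))))

    members-cardinality : HasCardinality (members H n) (length descriptions)
    members-cardinality = hasCardinality-length (members H n) Represents descriptions
      descriptions-unique represents-some represented
      (λ (_ , I-T , _) (_ , J-T , _) → realizes-unique L k I-T J-T)
      (λ {x} {y} {I} {J} → represents-injective {x} {y} {I} {J})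

  speed-expPoly : EventuallyExpPoly k (λ n → length (descriptions n))
  speed-expPoly = expPoly-cong
    (λ n → sym (card-cartesianProductWith (λ (T , w) → Valid T w) _,_ (templates L k) (allVecs (allFin k) n)))
    (expPoly-sum (λ T n → card (Valid T) (allVecs (allFin k) n)) (templates L k) valid-expPoly)

mainTheorem4 : (∀ {ℓ} → ExcludedMiddle ℓ) →
    (L : Language) {ℓ : Level} (H : Pred (Structure L) ℓ) →
    Hereditary H → ¬ Trivial H → Basic H →
    Σ ℕ λ k → Σ (Fin k → Polynomial) λ p →
    ∃ λ N → ∀ n → n ≥ N →
    ∃ λ m → HasCardinality (members H n) m × fromℕ m ≡ polyExpSum p n
mainTheorem4 em L H hereditary _ (k , classes) =
  k , proj₁ converted , threshold , λ n n≥N →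
    length (descriptions n) , members-cardinality n , trans (agrees n n≥N) (proj₂ converted n)
  where
  open Counting em L H hereditary k classes
  open EventuallyExpPoly speed-expPoly
  converted = newtonExpSum⇒polyExpSum coefficients
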